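{- Let $\alpha=\frac{2}{3}\pi$ and let $\alpha,\beta,\gamma,\delta,\epsilon$ denote distinct angles. Then a spherical tiling by $12$ angle congruent pentagons must have one of the following (unordered) angle combinations: 1. $\alpha^5$: the angles in the pentagon are $\alpha,\alpha,\alpha,\alpha,\alpha$. The anglewise vertex combination is $\{20\alpha^3\}$. 2. $\alpha^3\beta\gamma$: the angles in the pentagon are $\alpha,\alpha,\alpha,\beta,\gamma$, satisfying $\beta+\gamma=2\alpha$. The anglewise vertex combination is $\{8\alpha^3,12\alpha\beta\gamma\}$. 3. $\alpha^2\beta^2\gamma$: the angles in the pentagon are $\alpha,\alpha,\beta,\beta,\gamma$, satisfying $2\beta+\gamma=3\alpha$. The anglewise vertex combination is $\{8\alpha^3,12\beta^2\gamma\}$. 4. $\alpha^2\beta\gamma\delta$: the angles in the pentagon are $\alpha,\alpha,\beta,\gamma,\delta$, satisfying $\beta+\gamma+\delta=3\alpha$. The anglewise vertex combination is $\{8\alpha^3,12\beta\gamma\delta\}$. 5. $\alpha\beta\gamma\delta\epsilon$: the angles in the pentagon are $\alpha,\beta,\gamma,\delta,\epsilon$, satisfying $\gamma=3\alpha-2\beta$, $\delta=2\alpha-\beta$, $\epsilon=2\beta-\alpha$. There are three possible anglewise vertex combinations: $\{4\alpha\beta\delta,8\alpha\gamma\epsilon,4\beta^2\gamma,4\delta^2\epsilon\}$, $\{\alpha^3,2\alpha\beta\delta,7\alpha\gamma\epsilon,5\beta^2\gamma,5\delta^2\epsilon\}$, $\{2\alpha^3,6\alpha\gamma\epsilon,6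\beta^2\gamma,6\delta^2\epsilon\}$.
   Context: A spherical tiling is given by a finite connected graph nicely embedded in $S^2$ (edges may be nice curves, not necessarily great arcs) with all vertices of degree $\ge 3$; here all $12$ tiles are pentagons (five edges, enclosed by a simple closed curve). The angles of the tiles at each vertex sum to $2\pi$. Two polygons are angle congruent if there is a correspondence between their edges that preserves adjacency of edges and preserves the angles between adjacent edges; in a tiling by angle congruent pentagons any two tiles are angle congruent. A vertex is named by the multiset of angles at it: e.g. an $\alpha\beta\gamma$-vertex is a degree $3$ vertex at which the three angles are $\alpha,\beta,\gamma$, and a $\beta^2\gamma$-vertex one with angles $\beta,\beta,\gamma$. The anglewise vertex combination lists all vertices of the tiling with multiplicity: $\{8\alpha^3,12\beta\gamma\delta\}$ means that the tiling has exactly $8$ $\alpha^3$-vertices and $12$ $\beta\gamma\delta$-vertices and no others. The letters other than $\alpha$ are names that may be assigned suitably to the angles of the pentagon. -}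

module Defs where

open import Algebra.Bundles using (CommutativeRing)
import Algebra.Definitions.RawMonoid as RawMonoidDefs
open import Data.Fin.Base using (Fin; toℕ)
open import Data.Fin.Permutation using (Permutation′; _⟨$⟩ʳ_)
open import Data.Fin.Properties using (_≟_)
open import Data.List.Base
  using (List; []; _∷_; map; foldr; filter; length; replicate; concatMap; allFin; cartesianProduct)
import Data.List.Relation.Binary.Permutation.Setoid as SetoidPermutation
import Data.List.Relation.Unary.Unique.Setoid as SetoidUnique
open import Data.Nat.Base using (ℕ; suc; _≤_) renaming (_+_ to _+ℕ_; _*_ to _*ℕ_)
open import Data.Nat.DivMod using (_mod_)
open import Data.Product.Base using (Σ; ∃; _×_; _,_; uncurry)
open import Data.Sum.Base using (_⊎_)
open import Function.Bundles using (_⇔_)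
open import Level using (_⊔_) renaming (suc to lsuc)
open import Relation.Binary.Construct.Closure.ReflexiveTransitive using (Star)
open import Relation.Binary.Core using (Rel)
open import Relation.Binary.PropositionalEquality.Core using (_≡_; _≢_)
open import Relation.Binary.Structures using (IsStrictTotalOrder)
open import Relation.Nullary.Negation.Core using (¬_)

-- Angle measures live in an arbitrary ordered field, of which ℝ is the
-- intended instance (the trichotomy in IsStrictTotalOrder holds for ℝ
-- classically).

record OrderedField c ℓ₁ ℓ₂ : Set (lsuc (c ⊔ ℓ₁ ⊔ ℓ₂)) where
  infix 4 _<_
  field
    commutativeRing : CommutativeRing c ℓ₁
  open CommutativeRing commutativeRing public
  field
    _<_                : Rel Carrier ℓ₂
    isStrictTotalOrder : IsStrictTotalOrder _≈_ _<_
    0<1                : 0# < 1#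
    +-monoˡ-<          : ∀ z {x y} → x < y → x + z < y + z
    *-pos              : ∀ {x y} → 0# < x → 0# < y → 0# < x * y
    inverse            : ∀ x → ¬ (x ≈ 0#) → ∃ λ y → x * y ≈ 1#

cyc : Fin 5 → Fin 5
cyc i = suc (toℕ i) mod 5

-- (t , i) denotes the i-th side of the tile t, the sides of every tile being
-- numbered counterclockwise, and also the corner of t at the origin of that
-- side, i.e. the corner between the sides i - 1 and i.

Side : ℕ → Set
Side n = Fin n × Fin 5

next : ∀ {n} → Side n → Side n
next (t , i) = t , cyc i

sides : ∀ n → List (Side n)
sides n = cartesianProduct (allFin n) (allFin 5)

-- A connected graph embedded in the oriented sphere, all of whose n faces are
-- pentagons, encoded as a combinatorial map: an edge is a pair of sides glued
-- with opposite directions, and a vertex is a cycle of the rotation of corners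
-- around it.

record PentagonalTiling (n : ℕ) : Set where
  field
    mate            : Side n → Side n
    mate-involutive : ∀ s → mate (mate s) ≡ s
    mate-irrefl     : ∀ s → mate s ≢ s

  -- The mate of s ends where s starts, so the side following it starts there.
  rotate : Side n → Side n
  rotate s = next (mate s)

  field
    V            : ℕ
    origin       : Side n → Fin V
    origin-onto  : ∀ v → ∃ λ s → origin s ≡ v
    origin-orbit : ∀ s s′ → (origin s ≡ origin s′) ⇔ Star (λ x y → rotate x ≡ y) s s′

  cornersAt : Fin V → List (Side n)
  cornersAt v = filter (λ s → origin s ≟ v) (sides n)

  Adjacent : Fin V → Fin V → Set
  Adjacent v w = ∃ λ s → origin s ≡ v × origin (next s) ≡ w

  field
    degree≥3  : ∀ v → 3 ≤ length (cornersAt v)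
    connected : ∀ v w → Star Adjacent v w
    -- The boundary of a tile is a simple closed curve.
    simple    : ∀ t {i j} → origin (t , i) ≡ origin (t , j) → i ≡ j
    -- Twice V - E + F = 2, where 2 E = 5 n: the surface is a sphere.
    euler     : 2 *ℕ (V +ℕ n) ≡ 5 *ℕ n +ℕ 4

module Angles {c ℓ₁ ℓ₂} (K : OrderedField c ℓ₁ ℓ₂) where
  open OrderedField K public
  open RawMonoidDefs +-rawMonoid public using () renaming (_×_ to _·_)

  open SetoidPermutation setoid public using (_↭_; ↭-setoid)
  open SetoidPermutation ↭-setoid public using () renaming (_↭_ to _↭↭_)
  open SetoidUnique setoid public using (Unique)

  -- π is the measure of a straight angle.
  record AngledTiling (π : Carrier) (n : ℕ) : Set (c ⊔ ℓ₁ ⊔ ℓ₂) where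
    field
      tiling : PentagonalTiling n
    open PentagonalTiling tiling public
    field
      angle     : Side n → Carrier
      angle-pos : ∀ s → 0# < angle s

    anglesAt : Fin V → List Carrier
    anglesAt v = map angle (cornersAt v)

    tileAngles : Fin n → List Carrier
    tileAngles t = map (λ i → angle (t , i)) (allFin 5)

    field
      angle-sum : ∀ v → foldr _+_ 0# (anglesAt v) ≈ 2 · π

    -- The sides i and j of t are adjacent, with angle a between them.
    AngleBetween : Fin n → Fin 5 → Fin 5 → Carrier → Set ℓ₁
    AngleBetween t i j a =
      (j ≡ cyc i × a ≈ angle (t , j)) ⊎ (i ≡ cyc j × a ≈ angle (t , i))

    AngleCongruent : Fin n → Fin n → Set (c ⊔ ℓ₁)
    AngleCongruent t t′ = Σ (Permutation′ 5) λ f → ∀ i j a →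
      AngleBetween t i j a → AngleBetween t′ (f ⟨$⟩ʳ i) (f ⟨$⟩ʳ j) a

    TilesAngleCongruent : Set (c ⊔ ℓ₁)
    TilesAngleCongruent = ∀ t t′ → AngleCongruent t t′

    PentagonAngles : List Carrier → Set (c ⊔ ℓ₁)
    PentagonAngles as = ∀ t → tileAngles t ↭ as

    -- The vertices, each given by its multiset of angles, are exactly those
    -- listed, with the listed multiplicities.
    VertexCombination : List (ℕ × List Carrier) → Set (c ⊔ ℓ₁)
    VertexCombination ws = map anglesAt (allFin V) ↭↭ concatMap (uncurry replicate) ws

-- There are 20 vertices, all of degree 3, because 5 · 12 corners are spread over
-- the vertices counted by Euler's formula.  All tiles have the same angles, so
-- every angle of the pentagon occurs at exactly 12 of the 60 corners, and any two
-- of the five together occupy 24 > 20 corners: some vertex has two of its three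
-- corners among them.  For the ascending angles y₀ ≤ … ≤ y₄ this gives, for each
-- pair i, j, a relation y_p + y_q + y_r = 3α with p, q ∈ {i , j}.  The relations
-- for seven suitable pairs leave only two possibilities: two consecutive angles
-- equal α, or the angles are α - 2t, α - t, α, α + t, α + 2t.  In each resulting
-- configuration the triples of angles with sum 3α are known explicitly, and
-- counting the corners of each angle gives the multiplicities of the vertices.

module Submission where

open import Defs
import Algebra.Properties.AbelianGroup as AbelianGroupProperties
import Algebra.Properties.Monoid.Mult as MonoidMult
import Algebra.Properties.Ring as RingProperties
import Algebra.Properties.Semiring.Mult as SemiringMult
import Algebra.Solver.Ring as RingSolver
open import Algebra.Bundles using (CommutativeMonoid)
open import Algebra.Solver.Ring.AlmostCommutativeRing using (fromCommutativeRing; _-Raw-AlmostCommutative⟶_)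
open import Data.Fin.Base using (Fin; zero; suc; inject₁)
open import Data.Fin.Patterns
open import Data.Fin.Permutation as Permutation using (Permutation′; _⟨$⟩ʳ_; _⟨$⟩ˡ_; permutation; _∘ₚ_)
open import Data.Fin.Properties using (_≟_; suc-injective; all?; any?)
open import Data.Integer.Base as ℤ using (ℤ; +_; -[1+_]; 0ℤ; 1ℤ; -1ℤ)
import Data.Integer.Properties as ℤ
open import Data.List.Base
  using (List; []; _∷_; _++_; map; foldr; filter; length; replicate; concat; concatMap; tabulate; allFin; cartesianProduct)
import Data.List.Membership.DecPropositional as DecMembership
open import Data.List.Membership.Propositional using (_∈_)
import Data.List.Membership.Propositional.Properties as ∈
open import Data.List.Membership.Propositional.Properties.WithK using (unique∧set⇒bag)
import Data.List.Properties as List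
open import Data.List.Relation.Binary.BagAndSetEquality using (∼bag⇒↭)
open import Data.List.Relation.Binary.Permutation.Homogeneous as Homogeneous using (refl; prep; swap; trans)
import Data.List.Relation.Binary.Permutation.Propositional as ↭ₚ
import Data.List.Relation.Binary.Permutation.Propositional.Properties as ↭
import Data.List.Relation.Binary.Permutation.Setoid as SetoidPermutation
import Data.List.Relation.Binary.Permutation.Setoid.Properties as Setoid↭
open import Data.List.Relation.Binary.Pointwise as Pointwise using (Pointwise; []; _∷_)
open import Data.List.Relation.Unary.All as All using (All; []; _∷_)
import Data.List.Relation.Unary.All.Properties as All
open import Data.List.Relation.Unary.AllPairs using ([]; _∷_)
open import Data.List.Relation.Unary.Any as Any using (Any; here; there)
open import Data.List.Relation.Unary.Linked using (Linked; [-]; _∷_)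
import Data.List.Relation.Unary.Unique.Propositional.Properties as Unique
import Data.List.Sort as Sort
open import Data.Maybe.Base using (Maybe; just; nothing)
open import Data.Nat.Base as ℕ using (ℕ; zero; suc)
open import Data.Nat.ListAction using (sum)
open import Data.Nat.ListAction.Properties using (sum-↭)
import Data.Nat.Properties as ℕ
open import Data.Nat.Tactic.RingSolver using (solve-∀)
open import Data.Product.Base using (_×_; _,_; ∃; ∃-syntax; proj₁; proj₂; uncurry)
open import Data.Sum.Base using (_⊎_; inj₁; inj₂; [_,_]′)
open import Data.Vec.Base as Vec using (Vec; []; _∷_; lookup)
import Data.Vec.Properties as Vec
open import Data.Vec.Relation.Unary.All as VecAll using ([]; _∷_)
import Data.Vec.Relation.Unary.All.Properties as VecAllP
open import Function.Base using (id; _∘_)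
open import Function.Bundles using (mk⇔)
open import Level using (Level)
open import Relation.Binary.Bundles using (StrictTotalOrder; DecTotalOrder)
open import Relation.Binary.Definitions using (tri<; tri≈; tri>)
import Relation.Binary.Properties.StrictTotalOrder as STOProperties
open import Relation.Binary.PropositionalEquality as ≡ using (_≡_; _≢_)
import Relation.Binary.Reasoning.Setoid as SetoidReasoning
open import Relation.Nullary.Decidable using (Dec; yes; no; _×-dec_; _⊎-dec_; ¬?; toWitness)
open import Relation.Nullary.Negation.Core using (¬_; contradiction)

-- Twelve pentagons and twenty full vertices share one total angle, so the mean angle of the
-- pentagon is α. The relations between angles thus become homogeneous integer equations in the four
-- gaps between consecutive angles, and the ordering becomes nonnegativity of the gaps. This puts
-- the case analysis within reach of a decision procedure that the type checker runs. Five equal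
-- angles satisfy every such relation, so no branch can be closed by contradiction: each has to be
-- driven to one of the two outcomes, both of which hold for five equal angles. The obstacle to
-- counting is that angles may coincide and are compared only up to `≈`. Corners are therefore
-- labelled by colours, which are compared by `≡`. With the five positions as colours, "twelve
-- corners for each angle" holds literally even when some angles are equal. Once a pattern is fixed,
-- each angle is α plus a linear form in one or two free parameters, and a second decision procedure
-- finds all triples with sum 3α.

private variable
  a b : Level
  A : Set a
  B : Set b

infix 3 _↭ₚ_

_↭ₚ_ : List A → List A → Set _
_↭ₚ_ = ↭ₚ._↭_

-- Double counting

-- Induction step for `concat-fibres`: a new element enlarges exactly one fibre.
concat-tabulate-insert : ∀ {n} {x : A} (e : Fin n) (g h : Fin n → List A) →
  h e ≡ x ∷ g e → (∀ i → i ≢ e → h i ≡ g i) → concat (tabulate h) ↭ₚ x ∷ concat (tabulate g)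
concat-tabulate-insert {x = x} zero g h hₑ hᵢ = ↭ₚ.↭-reflexive
  (≡.cong₂ _++_ hₑ (≡.cong concat (List.tabulate-cong λ i → hᵢ (suc i) λ ())))
concat-tabulate-insert {x = x} (suc e) g h hₑ hᵢ = ↭ₚ.↭-trans
  (↭ₚ.↭-trans (↭ₚ.↭-reflexive (≡.cong (_++ _) (hᵢ zero λ ())))
    (↭.++⁺ˡ (g zero) (concat-tabulate-insert e (g ∘ suc) (h ∘ suc) hₑ λ i i≢e → hᵢ (suc i) (i≢e ∘ suc-injective))))
  (↭.shift x (g zero) _)

fibre : ∀ {n} → (A → Fin n) → List A → Fin n → List A
fibre f xs e = filter (λ x → f x ≟ e) xs

concat-fibres : ∀ {n} (f : A → Fin n) xs → concat (map (fibre f xs) (allFin n)) ↭ₚ xs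
concat-fibres {n = n} f [] = ↭ₚ.↭-reflexive (≡.trans (≡.cong concat (List.map-tabulate id (fibre f [])))
  (concat-[] n))
  where
  concat-[] : ∀ m → concat (tabulate {n = m} λ _ → []) ≡ []
  concat-[] zero    = ≡.refl
  concat-[] (suc m) = concat-[] m
concat-fibres {n = n} f (x ∷ xs) = begin
  concat (map (fibre f (x ∷ xs)) (allFin n))  ≡⟨ ≡.cong concat (List.map-tabulate id (fibre f (x ∷ xs))) ⟩
  concat (tabulate (fibre f (x ∷ xs)))        ↭⟨ concat-tabulate-insert (f x) (fibre f xs) (fibre f (x ∷ xs))
                                                   (List.filter-accept (λ y → f y ≟ f x) ≡.refl)
                                                   (λ i i≢fx → List.filter-reject (λ y → f y ≟ i) (i≢fx ∘ ≡.sym)) ⟩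
  x ∷ concat (tabulate (fibre f xs))          ≡⟨ ≡.cong (λ yss → x ∷ concat yss) (List.map-tabulate id (fibre f xs)) ⟨
  x ∷ concat (map (fibre f xs) (allFin n))    ↭⟨ ↭ₚ.prep x (concat-fibres f xs) ⟩
  x ∷ xs                                      ∎
  where open ↭ₚ.PermutationReasoning

map-cartesianProduct : ∀ {c} {C : Set c} (h : A × B → C) xs ys →
  map h (cartesianProduct xs ys) ≡ concat (map (λ x → map (λ y → h (x , y)) ys) xs)
map-cartesianProduct h []       ys = ≡.refl
map-cartesianProduct h (x ∷ xs) ys = ≡.trans (List.map-++ h (map (x ,_) ys) _)
  (≡.cong₂ _++_ (≡.sym (List.map-∘ ys)) (map-cartesianProduct h xs ys))

permutation-injective : ∀ {n} (f : Permutation′ n) {i j} → f ⟨$⟩ʳ i ≡ f ⟨$⟩ʳ j → i ≡ j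
permutation-injective f fi≡fj =
  ≡.trans (≡.sym (Permutation.inverseˡ f)) (≡.trans (≡.cong (f ⟨$⟩ˡ_) fi≡fj) (Permutation.inverseˡ f))

-- Both lists are free of duplicates and contain every index, so they agree as bags.
permute-allFin : ∀ {n} (f : Permutation′ n) → map (f ⟨$⟩ʳ_) (allFin n) ↭ₚ allFin n
permute-allFin {n} f = ∼bag⇒↭ (unique∧set⇒bag
  (Unique.map⁺ (permutation-injective f) (Unique.allFin⁺ n))
  (Unique.allFin⁺ n)
  (λ {j} → mk⇔ (λ _ → ∈.∈-allFin j)
    λ _ → ≡.subst (λ k → Any (k ≡_) _) (Permutation.inverseʳ f) (∈.∈-map⁺ (f ⟨$⟩ʳ_) (∈.∈-allFin (f ⟨$⟩ˡ j)))))

length*k≤sum : ∀ (f : A → ℕ) k xs → All (λ x → k ℕ.≤ f x) xs → length xs ℕ.* k ℕ.≤ sum (map f xs)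
length*k≤sum f k []       []           = ℕ.z≤n
length*k≤sum f k (x ∷ xs) (k≤fx ∷ k≤f) = ℕ.+-mono-≤ k≤fx (length*k≤sum f k xs k≤f)

sum≤length*k : ∀ (f : A → ℕ) k xs → All (λ x → f x ℕ.≤ k) xs → sum (map f xs) ℕ.≤ length xs ℕ.* k
sum≤length*k f k []       []           = ℕ.z≤n
sum≤length*k f k (x ∷ xs) (fx≤k ∷ f≤k) = ℕ.+-mono-≤ fx≤k (sum≤length*k f k xs f≤k)

minimal-sum⇒constant : ∀ (f : A → ℕ) k xs → All (λ x → k ℕ.≤ f x) xs → sum (map f xs) ℕ.≤ length xs ℕ.* k →
                       All (λ x → f x ≡ k) xs
minimal-sum⇒constant f k []       []           _   = []
minimal-sum⇒constant f k (x ∷ xs) (k≤fx ∷ k≤f) sum≤ =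
  ℕ.≤-antisym (ℕ.+-cancelʳ-≤ (length xs ℕ.* k) (f x) k
    (ℕ.≤-trans (ℕ.+-monoʳ-≤ (f x) (length*k≤sum f k xs k≤f)) sum≤)) k≤fx
  ∷ minimal-sum⇒constant f k xs k≤f (ℕ.+-cancelˡ-≤ k _ _ (ℕ.≤-trans (ℕ.+-monoˡ-≤ _ k≤fx) sum≤))

-- Finite sums in a commutative monoid

module Sums {c ℓ} (M : CommutativeMonoid c ℓ) where
  open CommutativeMonoid M renaming (Carrier to C; refl to ≈-refl; sym to ≈-sym; trans to ≈-trans)
  open MonoidMult monoid using () renaming (_×_ to _×ᴹ_)

  ∑ : List C → C
  ∑ = foldr _∙_ ε

  ∑-↭ : ∀ {xs ys} → xs ↭ₚ ys → ∑ xs ≈ ∑ ys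
  ∑-↭ xs↭ys = Setoid↭.foldr-commMonoid setoid isCommutativeMonoid (Homogeneous.map reflexive (↭ₚ.↭⇒↭ₛ xs↭ys))

  ∑-++ : ∀ xs ys → ∑ (xs ++ ys) ≈ ∑ xs ∙ ∑ ys
  ∑-++ []       ys = ≈-sym (identityˡ _)
  ∑-++ (x ∷ xs) ys = ≈-trans (∙-congˡ (∑-++ xs ys)) (≈-sym (assoc x _ _))

  ∑-concat : ∀ xss → ∑ (concat xss) ≈ ∑ (map ∑ xss)
  ∑-concat []         = ≈-refl
  ∑-concat (xs ∷ xss) = ≈-trans (∑-++ xs (concat xss)) (∙-congˡ (∑-concat xss))

  ∑-constant : ∀ (f : A → C) {s} xs → (∀ x → f x ≈ s) → ∑ (map f xs) ≈ length xs ×ᴹ s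
  ∑-constant f []       f≈s = ≈-refl
  ∑-constant f (x ∷ xs) f≈s = ∙-cong (f≈s x) (∑-constant f xs f≈s)

  ∑-fibres : ∀ {n} (f : A → Fin n) (h : A → C) xs →
             ∑ (map (λ e → ∑ (map h (fibre f xs e))) (allFin n)) ≈ ∑ (map h xs)
  ∑-fibres {n = n} f h xs = begin
    ∑ (map (λ e → ∑ (map h (fibre f xs e))) (allFin n))    ≡⟨ ≡.cong ∑ (List.map-∘ (allFin n)) ⟩
    ∑ (map ∑ (map (λ e → map h (fibre f xs e)) (allFin n))) ≈⟨ ∑-concat (map (λ e → map h (fibre f xs e)) (allFin n)) ⟨
    ∑ (concat (map (λ e → map h (fibre f xs e)) (allFin n))) ≡⟨ ≡.cong ∑ (List.map-concatMap h (fibre f xs) (allFin n)) ⟨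
    ∑ (map h (concat (map (fibre f xs) (allFin n))))         ≈⟨ ∑-↭ (↭.map⁺ h (concat-fibres f xs)) ⟩
    ∑ (map h xs)                                            ∎
    where open import Relation.Binary.Reasoning.Setoid setoid

  ∑-cartesianProduct : ∀ {b c} {B : Set b} {B′ : Set c} (h : B × B′ → C) xs ys →
    ∑ (map h (cartesianProduct xs ys)) ≈ ∑ (map (λ x → ∑ (map (λ y → h (x , y)) ys)) xs)
  ∑-cartesianProduct h xs ys = ≈-trans (reflexive (≡.cong ∑ (map-cartesianProduct h xs ys)))
    (≈-trans (∑-concat (map (λ x → map (λ y → h (x , y)) ys) xs)) (reflexive (≡.cong ∑ (≡.sym (List.map-∘ xs)))))

-- Tilings with twelve pentagonal tiles

module TilingProperties (T : PentagonalTiling 12) where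
  open PentagonalTiling T

  -- For twelve tiles Euler's formula reads 2 (V + 12) = 64.
  ∣V∣≡20 : length (allFin V) ≡ 20
  ∣V∣≡20 = ≡.trans (List.length-tabulate id) (ℕ.+-cancelʳ-≡ 12 V 20 (ℕ.*-cancelˡ-≡ (V ℕ.+ 12) 32 2 euler))

  module DoubleCount {c ℓ} (M : CommutativeMonoid c ℓ) where
    open CommutativeMonoid M using (Carrier; _≈_) renaming (trans to ≈-trans)
    open Sums M

    -- Every corner lies at one vertex and in one tile. The monoid is arbitrary because corners are
    -- counted in ℕ while their angles are added in the field.
    ∑-vertices≈∑-tiles : ∀ (h : Side 12 → Carrier) →
      ∑ (map (λ v → ∑ (map h (cornersAt v))) (allFin V)) ≈ ∑ (map (λ t → ∑ (map (λ i → h (t , i)) (allFin 5))) (allFin 12))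
    ∑-vertices≈∑-tiles h = ≈-trans (∑-fibres origin h (sides 12)) (∑-cartesianProduct h (allFin 12) (allFin 5))

  open DoubleCount ℕ.+-0-commutativeMonoid public renaming (∑-vertices≈∑-tiles to sum-vertices≡sum-tiles)

  length-as-sum : (xs : List A) → sum (map (λ _ → 1) xs) ≡ length xs
  length-as-sum []       = ≡.refl
  length-as-sum (x ∷ xs) = ≡.cong suc (length-as-sum xs)

  -- The 60 corners at 20 vertices average exactly the minimal degree 3, which leaves no slack.
  degree≡3 : ∀ v → length (cornersAt v) ≡ 3
  degree≡3 v = ≡.trans (≡.sym (length-as-sum (cornersAt v))) (All.lookup (minimal-sum⇒constant
    (λ v → sum (map (λ _ → 1) (cornersAt v))) 3 (allFin V)
    (All.universal (λ v → ℕ.≤-trans (degree≥3 v) (ℕ.≤-reflexive (≡.sym (length-as-sum (cornersAt v))))) _)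
    (ℕ.≤-reflexive (≡.trans (sum-vertices≡sum-tiles (λ _ → 1))
      (≡.cong (ℕ._* 3) (≡.sym ∣V∣≡20))))) (∈.∈-allFin v))

-- Symmetries of the cyclic order of five sides

cyc⁴ : Fin 5 → Fin 5
cyc⁴ i = cyc (cyc (cyc (cyc i)))

cyc∘cyc⁴ : ∀ i → cyc (cyc⁴ i) ≡ i
cyc∘cyc⁴ = λ { 0F → ≡.refl ; 1F → ≡.refl ; 2F → ≡.refl ; 3F → ≡.refl ; 4F → ≡.refl }

rotation : Permutation′ 5
rotation = permutation cyc⁴ cyc cyc∘cyc⁴ cyc∘cyc⁴

cyc-injective : ∀ {i j} → cyc i ≡ cyc j → i ≡ j
cyc-injective {i} {j} eq = ≡.trans (≡.sym (cyc∘cyc⁴ i)) (≡.trans (≡.cong cyc⁴ eq) (cyc∘cyc⁴ j))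

i≢cyc²i : ∀ i → i ≢ cyc (cyc i)
i≢cyc²i = λ { 0F () ; 1F () ; 2F () ; 3F () ; 4F () }

cyc-induction : ∀ {p} (P : Fin 5 → Set p) → (∀ i → P i → P (cyc i)) → P 0F → ∀ i → P i
cyc-induction P step p₀ = λ
  { 0F → p₀
  ; 1F → step 0F p₀
  ; 2F → step 1F (step 0F p₀)
  ; 3F → step 2F (step 1F (step 0F p₀))
  ; 4F → step 3F (step 2F (step 1F (step 0F p₀)))
  }

-- The two alternatives cannot hold at i and cyc i respectively, because f would
-- then identify i with cyc (cyc i).
keeps-or-reverses : ∀ {p q} {P : Fin 5 → Set p} {Q : Fin 5 → Set q} (f : Permutation′ 5) →
  (∀ i → (f ⟨$⟩ʳ cyc i ≡ cyc (f ⟨$⟩ʳ i) × P i) ⊎ (f ⟨$⟩ʳ i ≡ cyc (f ⟨$⟩ʳ cyc i) × Q i)) →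
  (∀ i → P i) ⊎ (∀ i → Q i)
keeps-or-reverses {P = P} {Q} f adjacent with adjacent 0F
... | inj₁ kept₀ = inj₁ (proj₂ ∘ cyc-induction _ step kept₀)
  where
  step : ∀ i → f ⟨$⟩ʳ cyc i ≡ cyc (f ⟨$⟩ʳ i) × P i → f ⟨$⟩ʳ cyc (cyc i) ≡ cyc (f ⟨$⟩ʳ cyc i) × P (cyc i)
  step i (eq , _) with adjacent (cyc i)
  ... | inj₁ kept      = kept
  ... | inj₂ (eq′ , _) = contradiction (permutation-injective f (cyc-injective (≡.trans (≡.sym eq) eq′))) (i≢cyc²i i)
... | inj₂ reversed₀ = inj₂ (proj₂ ∘ cyc-induction _ step reversed₀)
  where
  step : ∀ i → f ⟨$⟩ʳ i ≡ cyc (f ⟨$⟩ʳ cyc i) × Q i → f ⟨$⟩ʳ cyc i ≡ cyc (f ⟨$⟩ʳ cyc (cyc i)) × Q (cyc i)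
  step i (eq , _) with adjacent (cyc i)
  ... | inj₁ (eq′ , _) = contradiction (permutation-injective f (≡.trans eq (≡.sym eq′))) (i≢cyc²i i)
  ... | inj₂ reversed  = reversed

-- Linear forms with integer coefficients

Form : ℕ → Set
Form = Vec ℤ

infixl 6 _⊕_
infixr 7 _⊛_

_⊕_ : ∀ {n} → Form n → Form n → Form n
_⊕_ = Vec.zipWith ℤ._+_

_⊛_ : ∀ {n} → ℤ → Form n → Form n
m ⊛ F = Vec.map (m ℤ.*_) F

-- Fraction-free elimination: the coefficient at `k` cancels, and wherever `E` vanishes the result
-- is `lookup E k` times `F`.
clear : ∀ {n} → Fin n → Form n → Form n → Form n
clear k E F = lookup E k ⊛ F ⊕ (ℤ.- lookup F k) ⊛ E

-- A certificate that F ≥ 0 wherever the variables are nonnegative and all of Es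
-- vanish: eliminate one variable with each of Es until the coefficients of F are
-- nonnegative.  Elimination needs a positive pivot to preserve the sign of F.
Dominated : ∀ {m n} → Vec (Form n) m → Form n → Set
Dominated             []       F = VecAll.All (0ℤ ℤ.≤_) F
Dominated {m = suc m} (E ∷ Es) F =
    E ≡ Vec.replicate _ 0ℤ × Dominated Es F
  ⊎ Any (λ E′ → ∃ λ k → 0ℤ ℤ.< lookup E′ k × Dominated {m = m} (Vec.map (clear k E′) Es) (clear k E′ F))
        (E ∷ -1ℤ ⊛ E ∷ [])

dominated? : ∀ {m n} (Es : Vec (Form n) m) F → Dec (Dominated Es F)
dominated?             []       F = VecAll.all? (0ℤ ℤ.≤?_) F
dominated? {m = suc m} (E ∷ Es) F =
    (Vec.≡-dec ℤ._≟_ E _ ×-dec dominated? Es F)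
  ⊎-dec Any.any? (λ E′ → any? λ k →
          (0ℤ ℤ.<? lookup E′ k) ×-dec dominated? {m = m} (Vec.map (clear k E′) Es) (clear k E′ F)) _

-- 5 yᵢ - (y₀ + y₁ + y₂ + y₃ + y₄) in terms of the gaps yᵢ₊₁ - yᵢ.
excess : Fin 5 → Form 4
excess = lookup
  ( (ℤ.- + 4 ∷ ℤ.- + 3 ∷ ℤ.- + 2 ∷ ℤ.- + 1 ∷ [])
  ∷ (    + 1 ∷ ℤ.- + 3 ∷ ℤ.- + 2 ∷ ℤ.- + 1 ∷ [])
  ∷ (    + 1 ∷     + 2 ∷ ℤ.- + 2 ∷ ℤ.- + 1 ∷ [])
  ∷ (    + 1 ∷     + 2 ∷     + 3 ∷ ℤ.- + 1 ∷ [])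
  ∷ (    + 1 ∷     + 2 ∷     + 3 ∷     + 4 ∷ []) ∷ [])

Vanishing : ∀ {m n} → Vec (Form n) m → Form n → Set
Vanishing Es F = Dominated Es F × Dominated Es (-1ℤ ⊛ F)

vanishing? : ∀ {m n} (Es : Vec (Form n) m) F → Dec (Vanishing Es F)
vanishing? Es F = dominated? Es F ×-dec dominated? Es _

-- With t = y₃ - α, these forms vanish exactly when the five angles are α - 2t, α - t, α, α + t, α +
-- 2t.
progression : List (Form 4)
progression =
  excess 2F ∷
  (excess 1F ⊕ excess 3F) ∷
  (excess 0F ⊕ + 2 ⊛ excess 3F) ∷
  (excess 4F ⊕ -[1+ 1 ] ⊛ excess 3F) ∷ []

-- As y is ascending, yᵢ ≥ α ≥ yᵢ₊₁ says that both equal α.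
Settled : ∀ {m} → Vec (Form 4) m → Set
Settled Es =
    (∃ λ (i : Fin 4) → Dominated Es (excess (inject₁ i)) × Dominated Es (-1ℤ ⊛ excess (suc i)))
  ⊎ All (Vanishing Es) progression

settled? : ∀ {m} (Es : Vec (Form 4) m) → Dec (Settled Es)
settled? Es =
  any? (λ i → dominated? Es (excess (inject₁ i)) ×-dec dominated? Es _) ⊎-dec All.all? (vanishing? Es) progression

-- The mean angle being α, an excess is five times the deviation from α. The added form therefore
-- vanishes exactly when the three angles sum to 3α.
withTriple : ∀ {m} (Es : Vec (Form 4) m) (p q r : Fin 5) → Vec (Form 4) (suc m)
withTriple Es p q r = (excess p ⊕ excess q ⊕ excess r) ∷ Es

-- For each listed pair i, j a relation on p, q, r with p, q ∈ {i , j} is added,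
-- and in all cases the relations obtained so far settle the matter eventually.
Forced : ∀ {m} → List (Fin 5 × Fin 5) → Vec (Form 4) m → Set
Forced []             Es = Settled Es
Forced ((i , j) ∷ ps) Es = Settled Es ⊎ (∀ r →
  Forced ps (withTriple Es i i r) × Forced ps (withTriple Es i j r) × Forced ps (withTriple Es j j r))

forced? : ∀ {m} ps (Es : Vec (Form 4) m) → Dec (Forced ps Es)
forced? []             Es = settled? Es
forced? ((i , j) ∷ ps) Es = settled? Es ⊎-dec (all? λ r →
  forced? ps (withTriple Es i i r) ×-dec forced? ps (withTriple Es i j r) ×-dec forced? ps (withTriple Es j j r))

-- Found by a computer search.
pairs : List (Fin 5 × Fin 5)
pairs = (0F , 1F) ∷ (3F , 4F) ∷ (0F , 2F) ∷ (2F , 4F) ∷ (0F , 4F) ∷ (1F , 2F) ∷ (2F , 3F) ∷ []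

-- Evaluated during type checking. Each pair offers 15 alternatives, a third angle for each of three
-- choices of the first two, and a branch is closed as soon as it is settled.
pairs-force : Forced pairs []
pairs-force = toWitness {a? = forced? pairs []} _

-- Ordered fields

module OrderedFieldProperties {c ℓ₁ ℓ₂} (K : OrderedField c ℓ₁ ℓ₂) where
  open Angles K renaming (refl to ≈-refl; sym to ≈-sym; trans to ≈-trans)
  open MonoidMult +-monoid using (×-homo-+; ×-congʳ)
  open SemiringMult semiring using (×1-homo-*)
  open AbelianGroupProperties +-abelianGroup using (⁻¹-∙-comm; ε⁻¹≈ε; ⁻¹-involutive)
  open RingProperties ring using (-‿distribˡ-*; -‿distribʳ-*)

  strictTotalOrder : StrictTotalOrder c ℓ₁ ℓ₂
  strictTotalOrder = record { isStrictTotalOrder = isStrictTotalOrder }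

  decTotalOrder : DecTotalOrder _ _ _
  decTotalOrder = STOProperties.decTotalOrder strictTotalOrder

  open StrictTotalOrder strictTotalOrder public
    using (compare; irrefl; <-respˡ-≈; <-respʳ-≈) renaming (trans to <-trans; _≟_ to _≈?_)
  open DecTotalOrder decTotalOrder public using (_≤_; antisym)
    renaming (trans to ≤-trans)

  open SetoidReasoning setoid

  -- The canonical ring homomorphism. It provides the coefficients of the ring solver as well as the
  -- values of integer linear forms.
  ι : ℤ → Carrier
  ι (+ n)    = n · 1#
  ι -[1+ n ] = - (suc n · 1#)

  private
    1+-cancel : ∀ x y → (1# + x) - (1# + y) ≈ x - y
    1+-cancel x y = begin
      (1# + x) - (1# + y)      ≈⟨ +-cong (+-comm 1# x) (≈-sym (⁻¹-∙-comm 1# y)) ⟩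
      (x + 1#) + (- 1# - y)    ≈⟨ +-assoc x 1# _ ⟩
      x + (1# + (- 1# - y))    ≈⟨ +-congˡ (+-assoc 1# (- 1#) (- y)) ⟨
      x + ((1# - 1#) - y)      ≈⟨ +-congˡ (+-congʳ (-‿inverseʳ 1#)) ⟩
      x + (0# - y)             ≈⟨ +-congˡ (+-identityˡ (- y)) ⟩
      x - y                    ∎

  ι-⊖ : ∀ m n → ι (m ℤ.⊖ n) ≈ m · 1# - n · 1#
  ι-⊖ m       zero    = ≈-sym (≈-trans (+-congˡ ε⁻¹≈ε) (+-identityʳ _))
  ι-⊖ zero    (suc n) = ≈-sym (+-identityˡ _)
  ι-⊖ (suc m) (suc n) = begin
    ι (suc m ℤ.⊖ suc n)      ≡⟨ ≡.cong ι (ℤ.[1+m]⊖[1+n]≡m⊖n m n) ⟩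
    ι (m ℤ.⊖ n)              ≈⟨ ι-⊖ m n ⟩
    m · 1# - n · 1#          ≈⟨ 1+-cancel _ _ ⟨
    suc m · 1# - suc n · 1#  ∎

  ι-+ : ∀ m n → ι (m ℤ.+ n) ≈ ι m + ι n
  ι-+ (+ m)    (+ n)    = ×-homo-+ 1# m n
  ι-+ (+ m)    -[1+ n ] = ι-⊖ m (suc n)
  ι-+ -[1+ m ] (+ n)    = ≈-trans (ι-⊖ n (suc m)) (+-comm _ _)
  ι-+ -[1+ m ] -[1+ n ] = begin
    - (suc (suc (m ℕ.+ n)) · 1#)       ≈⟨ -‿cong (+-congˡ (×-homo-+ 1# (suc m) n)) ⟩
    - (1# + (suc m · 1# + n · 1#))     ≈⟨ -‿cong (+-assoc 1# _ _) ⟨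
    - (1# + suc m · 1# + n · 1#)       ≈⟨ -‿cong (+-congʳ (+-comm 1# _)) ⟩
    - (suc m · 1# + 1# + n · 1#)       ≈⟨ -‿cong (+-assoc _ 1# _) ⟩
    - (suc m · 1# + suc n · 1#)        ≈⟨ ⁻¹-∙-comm _ _ ⟨
    - (suc m · 1#) - suc n · 1#        ∎

  ι-neg : ∀ m → ι (ℤ.- m) ≈ - ι m
  ι-neg (+ zero)  = ≈-sym ε⁻¹≈ε
  ι-neg (+ suc n) = ≈-refl
  ι-neg -[1+ n ]  = ≈-sym (⁻¹-involutive _)

  private
    ι-*⁺ : ∀ m n → ι (+ m ℤ.* n) ≈ m · 1# * ι n
    ι-*⁺ m (+ n)    = ≈-trans (reflexive (≡.cong ι (≡.sym (ℤ.pos-* m n)))) (×1-homo-* m n)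
    ι-*⁺ m -[1+ n ] = begin
      ι (+ m ℤ.* -[1+ n ])         ≡⟨ ≡.cong ι (ℤ.neg-distribʳ-* (+ m) (+ suc n)) ⟨
      ι (ℤ.- (+ m ℤ.* + suc n))    ≈⟨ ι-neg (+ m ℤ.* + suc n) ⟩
      - ι (+ m ℤ.* + suc n)        ≈⟨ -‿cong (ι-*⁺ m (+ suc n)) ⟩
      - (m · 1# * (suc n · 1#))    ≈⟨ -‿distribʳ-* _ _ ⟩
      m · 1# * - (suc n · 1#)      ∎

  ι-* : ∀ m n → ι (m ℤ.* n) ≈ ι m * ι n
  ι-* (+ m)    n = ι-*⁺ m n
  ι-* -[1+ m ] n = begin
    ι (-[1+ m ] ℤ.* n)           ≡⟨ ≡.cong ι (ℤ.neg-distribˡ-* (+ suc m) n) ⟨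
    ι (ℤ.- (+ suc m ℤ.* n))      ≈⟨ ι-neg (+ suc m ℤ.* n) ⟩
    - ι (+ suc m ℤ.* n)          ≈⟨ -‿cong (ι-*⁺ (suc m) n) ⟩
    - (suc m · 1# * ι n)         ≈⟨ -‿distribˡ-* _ _ ⟩
    - (suc m · 1#) * ι n         ∎

  private
    morphism : ℤ.+-*-rawRing -Raw-AlmostCommutative⟶ fromCommutativeRing commutativeRing
    morphism = record
      { ⟦_⟧ = ι ; +-homo = ι-+ ; *-homo = ι-* ; -‿homo = ι-neg
      ; 0-homo = ≈-refl ; 1-homo = +-identityʳ 1# }

    ι-≟ : ∀ m n → Maybe (ι m ≈ ι n)
    ι-≟ m n with m ℤ.≟ n
    ... | yes ≡.refl = just ≈-refl
    ... | no  _      = nothing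

  module Solver = RingSolver ℤ.+-*-rawRing (fromCommutativeRing commutativeRing) morphism ι-≟
  open Solver using (solve; _:+_; _:*_; _:-_; :-_; con; _:=_; Polynomial)

  infixr 8 _:·_
  -- Unfolds in the same way as `_·_`, so that solver expressions evaluate to the multiples
  -- literally.
  _:·_ : ∀ {k} → ℕ → Polynomial k → Polynomial k
  zero  :· p = con 0ℤ
  suc n :· p = p :+ n :· p

  +-mono-<-≤ : ∀ {w x y z} → w < x → y ≤ z → w + y < x + z
  +-mono-<-≤ {x = x} {y} {z} w<x (inj₁ y<z) =
    <-trans (+-monoˡ-< y w<x) (<-respˡ-≈ (+-comm y x) (<-respʳ-≈ (+-comm z x) (+-monoˡ-< x y<z)))
  +-mono-<-≤ {y = y} w<x (inj₂ y≈z) = <-respʳ-≈ (+-congˡ y≈z) (+-monoˡ-< y w<x)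

  ≤-respʳ-≈ : ∀ {x y z} → y ≈ z → x ≤ y → x ≤ z
  ≤-respʳ-≈ y≈z x≤y = ≤-trans x≤y (inj₂ y≈z)

  pos+nonneg : ∀ {x y} → 0# < x → 0# ≤ y → 0# < x + y
  pos+nonneg 0<x 0≤y = <-respˡ-≈ (+-identityˡ 0#) (+-mono-<-≤ 0<x 0≤y)

  nonneg+nonneg : ∀ {x y} → 0# ≤ x → 0# ≤ y → 0# ≤ x + y
  nonneg+nonneg (inj₁ 0<x) 0≤y = inj₁ (pos+nonneg 0<x 0≤y)
  nonneg+nonneg (inj₂ 0≈x) 0≤y = ≤-respʳ-≈ (≈-trans (≈-sym (+-identityˡ _)) (+-congʳ 0≈x)) 0≤y

  nonneg*nonneg : ∀ {x y} → 0# ≤ x → 0# ≤ y → 0# ≤ x * y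
  nonneg*nonneg (inj₁ 0<x) (inj₁ 0<y) = inj₁ (*-pos 0<x 0<y)
  nonneg*nonneg {x} _ (inj₂ 0≈y) = inj₂ (≈-trans (≈-sym (zeroʳ x)) (*-congˡ 0≈y))
  nonneg*nonneg {y = y} (inj₂ 0≈x) _ = inj₂ (≈-trans (≈-sym (zeroˡ y)) (*-congʳ 0≈x))

  x<y⇒0<y-x : ∀ {x y} → x < y → 0# < y - x
  x<y⇒0<y-x {x} x<y = <-respˡ-≈ (-‿inverseʳ x) (+-monoˡ-< (- x) x<y)

  x≤y⇒0≤y-x : ∀ {x y} → x ≤ y → 0# ≤ y - x
  x≤y⇒0≤y-x (inj₁ x<y) = inj₁ (x<y⇒0<y-x x<y)
  x≤y⇒0≤y-x {x} (inj₂ x≈y) = inj₂ (≈-trans (≈-sym (-‿inverseʳ x)) (+-congʳ x≈y))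

  0≤y-x⇒x≤y : ∀ {x y} → 0# ≤ y - x → x ≤ y
  0≤y-x⇒x≤y {x} {y} (inj₁ 0<y-x) =
    inj₁ (<-respˡ-≈ (+-identityˡ x) (<-respʳ-≈ (solve 2 (λ x y → y :- x :+ x := y) ≈-refl x y) (+-monoˡ-< x 0<y-x)))
  0≤y-x⇒x≤y {x} {y} (inj₂ 0≈y-x) =
    inj₂ (≈-trans (≈-sym (+-identityˡ x)) (≈-trans (+-congʳ 0≈y-x) (solve 2 (λ x y → y :- x :+ x := y) ≈-refl x y)))

  *-cancel-nonneg : ∀ {x y} → 0# < x → 0# ≤ x * y → 0# ≤ y
  *-cancel-nonneg {x} {y} 0<x 0≤xy with compare 0# y
  ... | tri< 0<y _ _ = inj₁ 0<y
  ... | tri≈ _ 0≈y _ = inj₂ 0≈y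
  ... | tri> _ _ y<0 = contradiction
    (<-respʳ-≈ (solve 2 (λ x y → x :* y :+ x :* (con 0ℤ :- y) := con 0ℤ) ≈-refl x y)
      (<-respʳ-≈ (+-comm _ _) (pos+nonneg (*-pos 0<x (x<y⇒0<y-x y<0)) 0≤xy)))
    (irrefl ≈-refl)

  0<ι[1+n] : ∀ n → 0# < ι (+ suc n)
  0<ι[1+n] zero    = <-respʳ-≈ (≈-sym (+-identityʳ 1#)) 0<1
  0<ι[1+n] (suc n) = pos+nonneg 0<1 (inj₁ (0<ι[1+n] n))

  ι-pos : ∀ {m} → 0ℤ ℤ.< m → 0# < ι m
  ι-pos {+ suc n} _ = 0<ι[1+n] n
  ι-pos {+ zero} (ℤ.+<+ ())

  ι-nonneg : ∀ {m} → 0ℤ ℤ.≤ m → 0# ≤ ι m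
  ι-nonneg {+ zero}  _ = inj₂ ≈-refl
  ι-nonneg {+ suc n} _ = inj₁ (0<ι[1+n] n)

  ·≈ι* : ∀ n x → n · x ≈ ι (+ n) * x
  ·≈ι* zero    x = ≈-sym (zeroˡ x)
  ·≈ι* (suc n) x = begin
    x + n · x                ≈⟨ +-cong (≈-sym (*-identityˡ x)) (·≈ι* n x) ⟩
    1# * x + ι (+ n) * x     ≈⟨ distribʳ x 1# _ ⟨
    (1# + ι (+ n)) * x       ∎

  -- Characteristic zero comes from the order: if a positive multiple of `x` is zero, then both `x`
  -- and its negative are nonnegative.
  ι*-cancel : ∀ m {x} → m ≢ 0ℤ → ι m * x ≈ 0# → x ≈ 0#
  ι*-cancel (+ zero) m≢0 _ = contradiction ≡.refl m≢0
  ι*-cancel (+ suc n) {x} _ mx≈0 = antisym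
    (0≤y-x⇒x≤y (*-cancel-nonneg (0<ι[1+n] n) (inj₂ (≈-sym (≈-trans
      (solve 2 (λ m x → m :* (con 0ℤ :- x) := :- (m :* x)) ≈-refl (ι (+ suc n)) x)
      (≈-trans (-‿cong mx≈0) ε⁻¹≈ε))))))
    (*-cancel-nonneg (0<ι[1+n] n) (inj₂ (≈-sym mx≈0)))
  ι*-cancel -[1+ n ] {x} _ mx≈0 = ι*-cancel (+ suc n) (λ ()) (begin
    ι (+ suc n) * x        ≈⟨ solve 2 (λ m x → m :* x := :- (:- m :* x)) ≈-refl (ι (+ suc n)) x ⟩
    - (ι -[1+ n ] * x)     ≈⟨ -‿cong mx≈0 ⟩
    - 0#                   ≈⟨ ε⁻¹≈ε ⟩
    0#                     ∎)

  x-y≈0⇒x≈y : ∀ {x y} → x - y ≈ 0# → x ≈ y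
  x-y≈0⇒x≈y {x} {y} x-y≈0 = begin
    x          ≈⟨ solve 2 (λ x y → x := x :- y :+ y) ≈-refl x y ⟩
    x - y + y  ≈⟨ +-congʳ x-y≈0 ⟩
    0# + y     ≈⟨ +-identityˡ y ⟩
    y          ∎

  x≈y⇒x-y≈0 : ∀ {x y} → x ≈ y → x - y ≈ 0#
  x≈y⇒x-y≈0 {y = y} x≈y = ≈-trans (+-congʳ x≈y) (-‿inverseʳ y)

  ·-cancelˡ : ∀ n {x y} → suc n · x ≈ suc n · y → x ≈ y
  ·-cancelˡ n {x} {y} nx≈ny = x-y≈0⇒x≈y (ι*-cancel (+ suc n) (λ ()) (begin
    ι (+ suc n) * (x - y)
      ≈⟨ solve 3 (λ m x y → m :* (x :- y) := m :* x :- m :* y) ≈-refl (ι (+ suc n)) x y ⟩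
    ι (+ suc n) * x - ι (+ suc n) * y    ≈⟨ +-cong (·≈ι* (suc n) x) (-‿cong (·≈ι* (suc n) y)) ⟨
    suc n · x - suc n · y                ≈⟨ x≈y⇒x-y≈0 nx≈ny ⟩
    0#                                   ∎))

  ⟦_⟧ : ∀ {n} → Form n → Vec Carrier n → Carrier
  ⟦ [] ⟧    []       = 0#
  ⟦ m ∷ F ⟧ (x ∷ xs) = ι m * x + ⟦ F ⟧ xs

  ⟦⊕⟧ : ∀ {n} (F G : Form n) xs → ⟦ F ⊕ G ⟧ xs ≈ ⟦ F ⟧ xs + ⟦ G ⟧ xs
  ⟦⊕⟧ []      []      []       = ≈-sym (+-identityˡ 0#)
  ⟦⊕⟧ (m ∷ F) (n ∷ G) (x ∷ xs) = begin
    ι (m ℤ.+ n) * x + ⟦ F ⊕ G ⟧ xs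
      ≈⟨ +-cong (*-congʳ (ι-+ m n)) (⟦⊕⟧ F G xs) ⟩
    (ι m + ι n) * x + (⟦ F ⟧ xs + ⟦ G ⟧ xs)
      ≈⟨ solve 5 (λ m n x f g →
           (m :+ n) :* x :+ (f :+ g) := m :* x :+ f :+ (n :* x :+ g)) ≈-refl (ι m) (ι n) x _ _ ⟩
    ι m * x + ⟦ F ⟧ xs + (ι n * x + ⟦ G ⟧ xs) ∎

  ⟦⊛⟧ : ∀ {n} m (F : Form n) xs → ⟦ m ⊛ F ⟧ xs ≈ ι m * ⟦ F ⟧ xs
  ⟦⊛⟧ m []      []       = ≈-sym (zeroʳ (ι m))
  ⟦⊛⟧ m (n ∷ F) (x ∷ xs) = begin
    ι (m ℤ.* n) * x + ⟦ m ⊛ F ⟧ xs     ≈⟨ +-cong (*-congʳ (ι-* m n)) (⟦⊛⟧ m F xs) ⟩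
    ι m * ι n * x + ι m * ⟦ F ⟧ xs
      ≈⟨ solve 4 (λ m n x f → m :* n :* x :+ m :* f := m :* (n :* x :+ f)) ≈-refl (ι m) (ι n) x _ ⟩
    ι m * (ι n * x + ⟦ F ⟧ xs)         ∎

  ⟦clear⟧ : ∀ {n} k (E F : Form n) {xs} → ⟦ E ⟧ xs ≈ 0# → ⟦ clear k E F ⟧ xs ≈ ι (lookup E k) * ⟦ F ⟧ xs
  ⟦clear⟧ k E F {xs} E≈0 = begin
    ⟦ clear k E F ⟧ xs
      ≈⟨ ⟦⊕⟧ (lookup E k ⊛ F) _ xs ⟩
    ⟦ lookup E k ⊛ F ⟧ xs + ⟦ (ℤ.- lookup F k) ⊛ E ⟧ xs
      ≈⟨ +-cong (⟦⊛⟧ (lookup E k) F xs) (⟦⊛⟧ (ℤ.- lookup F k) E xs) ⟩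
    ι (lookup E k) * ⟦ F ⟧ xs + ι (ℤ.- lookup F k) * ⟦ E ⟧ xs
      ≈⟨ +-congˡ (≈-trans (*-congˡ E≈0) (zeroʳ _)) ⟩
    ι (lookup E k) * ⟦ F ⟧ xs + 0#
      ≈⟨ +-identityʳ _ ⟩
    ι (lookup E k) * ⟦ F ⟧ xs ∎

  ⟦⟧-nonneg : ∀ {n} {F : Form n} {xs} → VecAll.All (0ℤ ℤ.≤_) F → VecAll.All (0# ≤_) xs → 0# ≤ ⟦ F ⟧ xs
  ⟦⟧-nonneg []          []          = inj₂ ≈-refl
  ⟦⟧-nonneg (0≤m ∷ 0≤F) (0≤x ∷ 0≤xs) = nonneg+nonneg (nonneg*nonneg (ι-nonneg 0≤m) 0≤x) (⟦⟧-nonneg 0≤F 0≤xs)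

  -- On the common zero set each elimination multiplies `F` by its positive pivot, so a sign
  -- established for the final form carries back to `F`. The remaining relations still vanish after
  -- the elimination.
  dominated-sound : ∀ {m n} (Es : Vec (Form n) m) F {xs} → VecAll.All (0# ≤_) xs →
                    VecAll.All (λ E → ⟦ E ⟧ xs ≈ 0#) Es → Dominated Es F → 0# ≤ ⟦ F ⟧ xs
  dominated-sound             []       F 0≤xs []          0≤F = ⟦⟧-nonneg 0≤F 0≤xs
  dominated-sound             (E ∷ Es) F 0≤xs (E≈0 ∷ Es≈0) (inj₁ (_ , dom)) = dominated-sound Es F 0≤xs Es≈0 dom
  dominated-sound {m = suc m} {n = n} (E ∷ Es) F {xs} 0≤xs (E≈0 ∷ Es≈0) (inj₂ some) = pivot some
    where
    using-pivot : ∀ E′ → ⟦ E′ ⟧ xs ≈ 0# →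
                  (∃ λ k → 0ℤ ℤ.< lookup E′ k × Dominated {m = m} (Vec.map (clear k E′) Es) (clear k E′ F)) →
                  0# ≤ ⟦ F ⟧ xs
    using-pivot E′ E′≈0 (k , 0<e , dom) =
      *-cancel-nonneg (ι-pos 0<e) (≤-respʳ-≈ (⟦clear⟧ k E′ F E′≈0)
        (dominated-sound {m = m} (Vec.map (clear k E′) Es) (clear k E′ F) 0≤xs
          (VecAllP.map⁺ (VecAll.map (λ {D} D≈0 → ≈-trans (⟦clear⟧ k E′ D E′≈0) (≈-trans (*-congˡ D≈0) (zeroʳ _))) Es≈0)) dom))
    pivot : _ → 0# ≤ ⟦ F ⟧ xs
    pivot (here found)         = using-pivot E E≈0 found
    -- A negated relation still vanishes, and it turns a negative coefficient into an admissible
    -- pivot.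
    pivot (there (here found)) = using-pivot (-1ℤ ⊛ E) (≈-trans (⟦⊛⟧ -1ℤ E xs) (≈-trans (*-congˡ E≈0) (zeroʳ _))) found

  vanishing-sound : ∀ {m n} (Es : Vec (Form n) m) F {xs} → VecAll.All (0# ≤_) xs →
                    VecAll.All (λ E → ⟦ E ⟧ xs ≈ 0#) Es → Vanishing Es F → ⟦ F ⟧ xs ≈ 0#
  vanishing-sound Es F {xs} 0≤xs Es≈0 (dom⁺ , dom⁻) = antisym
    (0≤y-x⇒x≤y (≤-respʳ-≈ (≈-trans (⟦⊛⟧ -1ℤ F xs) (solve 1 (λ f → con -1ℤ :* f := con 0ℤ :- f) ≈-refl _))
      (dominated-sound Es _ 0≤xs Es≈0 dom⁻)))
    (dominated-sound Es F 0≤xs Es≈0 dom⁺)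

  -- Five ascending angles with mean α

  Consecutive : Carrier → (Fin 5 → Carrier) → Set ℓ₁
  Consecutive α y = ∃ λ (i : Fin 4) → y (inject₁ i) ≈ α × y (suc i) ≈ α

  -- The fourth angle is taken as the parameter because it becomes β in the fifth configuration,
  -- where these equations have to hold in this form.
  Arithmetic : Carrier → (Fin 5 → Carrier) → Set ℓ₁
  Arithmetic α y = y 2F ≈ α × y 1F ≈ 2 · α - y 3F × y 0F ≈ 3 · α - 2 · y 3F × y 4F ≈ 2 · y 3F - α

  module Ascending (α : Carrier) (y : Fin 5 → Carrier)
    (y-sum : y 0F + (y 1F + (y 2F + (y 3F + (y 4F + 0#)))) ≈ 5 · α)
    (y-ascending : ∀ (i : Fin 4) → y (inject₁ i) ≤ y (suc i)) where

    gaps : Vec Carrier 4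
    gaps = Vec.tabulate λ i → y (suc i) - y (inject₁ i)

    0≤gaps : VecAll.All (0# ≤_) gaps
    0≤gaps = VecAllP.tabulate⁺ λ i → x≤y⇒0≤y-x (y-ascending i)

    private
      gaps-identity : ∀ i → ⟦ excess i ⟧ gaps ≈ ι (+ 5) * y i - (y 0F + (y 1F + (y 2F + (y 3F + (y 4F + 0#)))))
      gaps-identity = λ
        { 0F → solve 5 (λ a b c d e →
            combination (ℤ.- + 4) (ℤ.- + 3) (ℤ.- + 2) (ℤ.- + 1) a b c d e := con (+ 5) :* a :- total a b c d e) ≈-refl _ _ _ _ _
        ; 1F → solve 5 (λ a b c d e →
            combination (+ 1) (ℤ.- + 3) (ℤ.- + 2) (ℤ.- + 1) a b c d e := con (+ 5) :* b :- total a b c d e) ≈-refl _ _ _ _ _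
        ; 2F → solve 5 (λ a b c d e →
            combination (+ 1) (+ 2) (ℤ.- + 2) (ℤ.- + 1) a b c d e := con (+ 5) :* c :- total a b c d e) ≈-refl _ _ _ _ _
        ; 3F → solve 5 (λ a b c d e →
            combination (+ 1) (+ 2) (+ 3) (ℤ.- + 1) a b c d e := con (+ 5) :* d :- total a b c d e) ≈-refl _ _ _ _ _
        ; 4F → solve 5 (λ a b c d e →
            combination (+ 1) (+ 2) (+ 3) (+ 4) a b c d e := con (+ 5) :* e :- total a b c d e) ≈-refl _ _ _ _ _
        }
        where
        total : ∀ {k} (a b c d e : Polynomial k) → Polynomial k
        total a b c d e = a :+ (b :+ (c :+ (d :+ (e :+ con 0ℤ))))
        combination : ∀ {k} (m n p q : ℤ) (a b c d e : Polynomial k) → Polynomial k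
        combination m n p q a b c d e =
          con m :* (b :- a) :+ (con n :* (c :- b) :+ (con p :* (d :- c) :+ (con q :* (e :- d) :+ con 0ℤ)))

    ⟦excess⟧ : ∀ i → ⟦ excess i ⟧ gaps ≈ ι (+ 5) * (y i - α)
    ⟦excess⟧ i = begin
      ⟦ excess i ⟧ gaps        ≈⟨ gaps-identity i ⟩
      ι (+ 5) * y i - _        ≈⟨ +-congˡ (-‿cong y-sum) ⟩
      ι (+ 5) * y i - 5 · α
        ≈⟨ solve 2 (λ y α → con (+ 5) :* y :- 5 :· α := con (+ 5) :* (y :- α)) ≈-refl (y i) α ⟩
      ι (+ 5) * (y i - α)      ∎

    Full : Fin 5 → Fin 5 → Fin 5 → Set ℓ₁
    Full p q r = y p + (y q + (y r + 0#)) ≈ 3 · α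

    FullWithTwoOf : Fin 5 × Fin 5 → Set ℓ₁
    FullWithTwoOf (i , j) = ∃ λ r → Full i i r ⊎ Full i j r ⊎ Full j j r

    full⇒vanishing : ∀ p q r → Full p q r → ⟦ excess p ⊕ excess q ⊕ excess r ⟧ gaps ≈ 0#
    full⇒vanishing p q r full = begin
      ⟦ excess p ⊕ excess q ⊕ excess r ⟧ gaps
        ≈⟨ ≈-trans (⟦⊕⟧ (excess p ⊕ excess q) (excess r) gaps) (+-congʳ (⟦⊕⟧ (excess p) (excess q) gaps)) ⟩
      ⟦ excess p ⟧ gaps + ⟦ excess q ⟧ gaps + ⟦ excess r ⟧ gaps
        ≈⟨ +-cong (+-cong (⟦excess⟧ p) (⟦excess⟧ q)) (⟦excess⟧ r) ⟩
      ι (+ 5) * (y p - α) + ι (+ 5) * (y q - α) + ι (+ 5) * (y r - α)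
        ≈⟨ solve 4 (λ p q r α → con (+ 5) :* (p :- α) :+ con (+ 5) :* (q :- α) :+ con (+ 5) :* (r :- α)
             := con (+ 5) :* (p :+ (q :+ (r :+ con 0ℤ)) :- 3 :· α)) ≈-refl (y p) (y q) (y r) α ⟩
      ι (+ 5) * (y p + (y q + (y r + 0#)) - 3 · α)
        ≈⟨ ≈-trans (*-congˡ (x≈y⇒x-y≈0 full)) (zeroʳ _) ⟩
      0# ∎

    settled-sound : ∀ {m} (Es : Vec (Form 4) m) → VecAll.All (λ E → ⟦ E ⟧ gaps ≈ 0#) Es →
                    Settled Es → Consecutive α y ⊎ Arithmetic α y
    settled-sound Es Es≈0 (inj₁ (i , dom₁ , dom₂)) =
      inj₁ (i , antisym yᵢ≤α α≤yᵢ , antisym yᵢ₊₁≤α (≤-trans α≤yᵢ (y-ascending i)))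
      where
      α≤yᵢ : α ≤ y (inject₁ i)
      α≤yᵢ = 0≤y-x⇒x≤y (*-cancel-nonneg (0<ι[1+n] 4)
        (≤-respʳ-≈ (⟦excess⟧ (inject₁ i)) (dominated-sound Es (excess (inject₁ i)) 0≤gaps Es≈0 dom₁)))
      yᵢ₊₁≤α : y (suc i) ≤ α
      yᵢ₊₁≤α = 0≤y-x⇒x≤y (*-cancel-nonneg (0<ι[1+n] 4) (≤-respʳ-≈ (begin
        ⟦ -1ℤ ⊛ excess (suc i) ⟧ gaps             ≈⟨ ⟦⊛⟧ -1ℤ (excess (suc i)) gaps ⟩
        ι -1ℤ * ⟦ excess (suc i) ⟧ gaps           ≈⟨ *-congˡ (⟦excess⟧ (suc i)) ⟩
        ι -1ℤ * (ι (+ 5) * (y (suc i) - α))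
          ≈⟨ solve 2 (λ y α → con -1ℤ :* (con (+ 5) :* (y :- α)) := con (+ 5) :* (α :- y)) ≈-refl _ _ ⟩
        ι (+ 5) * (α - y (suc i))                   ∎)
        (dominated-sound Es (-1ℤ ⊛ excess (suc i)) 0≤gaps Es≈0 dom₂)))
      yᵢ≤α : y (inject₁ i) ≤ α
      yᵢ≤α = ≤-trans (y-ascending i) yᵢ₊₁≤α
    settled-sound Es Es≈0 (inj₂ (v₂ ∷ v₁ ∷ v₀ ∷ v₄ ∷ [])) = inj₂
      ( x-y≈0⇒x≈y (cancel5 (≈-trans (≈-sym (⟦excess⟧ 2F)) (vanish (excess 2F) v₂)))
      , x-y≈0⇒x≈y (cancel5 (begin
          ι (+ 5) * (y 1F - (2 · α - y 3F))
            ≈⟨ solve 3 (λ a b c →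
                 con (+ 5) :* (b :- (2 :· a :- c))
                 := con (+ 5) :* (b :- a) :+ con (+ 5) :* (c :- a)) ≈-refl α (y 1F) (y 3F) ⟩
          ι (+ 5) * (y 1F - α) + ι (+ 5) * (y 3F - α)
            ≈⟨ +-cong (⟦excess⟧ 1F) (⟦excess⟧ 3F) ⟨
          ⟦ excess 1F ⟧ gaps + ⟦ excess 3F ⟧ gaps
            ≈⟨ ⟦⊕⟧ (excess 1F) (excess 3F) gaps ⟨
          ⟦ excess 1F ⊕ excess 3F ⟧ gaps
            ≈⟨ vanish (excess 1F ⊕ excess 3F) v₁ ⟩
          0# ∎))
      , x-y≈0⇒x≈y (cancel5 (begin
          ι (+ 5) * (y 0F - (3 · α - 2 · y 3F))
            ≈⟨ solve 3 (λ a b c →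
                 con (+ 5) :* (b :- (3 :· a :- 2 :· c))
                 := con (+ 5) :* (b :- a) :+ con (+ 2) :* (con (+ 5) :* (c :- a))) ≈-refl α (y 0F) (y 3F) ⟩
          ι (+ 5) * (y 0F - α) + ι (+ 2) * (ι (+ 5) * (y 3F - α))
            ≈⟨ combination 0F (+ 2) ⟨
          ⟦ excess 0F ⊕ + 2 ⊛ excess 3F ⟧ gaps
            ≈⟨ vanish (excess 0F ⊕ + 2 ⊛ excess 3F) v₀ ⟩
          0# ∎))
      , x-y≈0⇒x≈y (cancel5 (begin
          ι (+ 5) * (y 4F - (2 · y 3F - α))
            ≈⟨ solve 3 (λ a b c →
                 con (+ 5) :* (b :- (2 :· c :- a))
                 := con (+ 5) :* (b :- a) :+ con -[1+ 1 ] :* (con (+ 5) :* (c :- a))) ≈-refl α (y 4F) (y 3F) ⟩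
          ι (+ 5) * (y 4F - α) + ι -[1+ 1 ] * (ι (+ 5) * (y 3F - α))
            ≈⟨ combination 4F -[1+ 1 ] ⟨
          ⟦ excess 4F ⊕ -[1+ 1 ] ⊛ excess 3F ⟧ gaps
            ≈⟨ vanish (excess 4F ⊕ -[1+ 1 ] ⊛ excess 3F) v₄ ⟩
          0# ∎)) )
      where
      vanish : ∀ F → Vanishing Es F → ⟦ F ⟧ gaps ≈ 0#
      vanish F = vanishing-sound Es F 0≤gaps Es≈0
      cancel5 : ∀ {x} → ι (+ 5) * x ≈ 0# → x ≈ 0#
      cancel5 = ι*-cancel (+ 5) (λ ())
      combination : ∀ i m → ⟦ excess i ⊕ m ⊛ excess 3F ⟧ gaps ≈ ι (+ 5) * (y i - α) + ι m * (ι (+ 5) * (y 3F - α))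
      combination i m = ≈-trans (⟦⊕⟧ (excess i) (m ⊛ excess 3F) gaps)
        (+-cong (⟦excess⟧ i) (≈-trans (⟦⊛⟧ m (excess 3F) gaps) (*-congˡ (⟦excess⟧ 3F))))

    forced-sound : ∀ {m} ps (Es : Vec (Form 4) m) → VecAll.All (λ E → ⟦ E ⟧ gaps ≈ 0#) Es →
                   All FullWithTwoOf ps → Forced ps Es → Consecutive α y ⊎ Arithmetic α y
    forced-sound []             Es Es≈0 []                   settled        = settled-sound Es Es≈0 settled
    forced-sound (_ ∷ _)        Es Es≈0 _                    (inj₁ settled) = settled-sound Es Es≈0 settled
    forced-sound ((i , j) ∷ ps) Es Es≈0 ((r , full) ∷ fulls) (inj₂ forced) with full | forced r
    ... | inj₁ iir        | (f , _ , _) = forced-sound ps _ (full⇒vanishing i i r iir ∷ Es≈0) fulls f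
    ... | inj₂ (inj₁ ijr) | (_ , f , _) = forced-sound ps _ (full⇒vanishing i j r ijr ∷ Es≈0) fulls f
    ... | inj₂ (inj₂ jjr) | (_ , _ , f) = forced-sound ps _ (full⇒vanishing j j r jjr ∷ Es≈0) fulls f

-- Vertices as triples of colours

private
  indicator : ∀ {p} {P : Set p} → Dec P → ℕ
  indicator (yes _) = 1
  indicator (no  _) = 0

  sum-constant : ∀ {a} {A : Set a} (f : A → ℕ) k xs → All (λ x → f x ≡ k) xs → sum (map f xs) ≡ length xs ℕ.* k
  sum-constant f k []       []         = ≡.refl
  sum-constant f k (x ∷ xs) (eq ∷ eqs) = ≡.cong₂ ℕ._+_ eq (sum-constant f k xs eqs)

  sum>⇒∃> : ∀ {a} {A : Set a} (f : A → ℕ) k xs → length xs ℕ.* k ℕ.< sum (map f xs) → Any (λ x → k ℕ.< f x) xs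
  sum>⇒∃> f k xs lk<sum with Any.any? (λ x → k ℕ.<? f x) xs
  ... | yes some = some
  ... | no none  = contradiction (sum≤length*k f k xs (All.map ℕ.≮⇒≥ (All.¬Any⇒All¬ xs none))) (ℕ.<⇒≱ lk<sum)

arrangements : ∀ {a} {A : Set a} → A → A → A → List (List A)
arrangements a b c =
  (a ∷ b ∷ c ∷ []) ∷ (a ∷ c ∷ b ∷ []) ∷ (b ∷ a ∷ c ∷ []) ∷
  (b ∷ c ∷ a ∷ []) ∷ (c ∷ a ∷ b ∷ []) ∷ (c ∷ b ∷ a ∷ []) ∷ []

arrangements-↭ : ∀ {a} {A : Set a} (x y z : A) {l} → l ∈ arrangements x y z → x ∷ y ∷ z ∷ [] ↭ₚ l
arrangements-↭ x y z = All.lookup {P = x ∷ y ∷ z ∷ [] ↭ₚ_}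
  ( ↭ₚ.↭-refl
  ∷ ↭ₚ.prep x (↭ₚ.swap y z ↭ₚ.↭-refl)
  ∷ ↭ₚ.swap x y ↭ₚ.↭-refl
  ∷ ↭ₚ.↭-trans (↭ₚ.swap x y ↭ₚ.↭-refl) (↭ₚ.prep y (↭ₚ.swap x z ↭ₚ.↭-refl))
  ∷ ↭ₚ.↭-trans (↭ₚ.prep x (↭ₚ.swap y z ↭ₚ.↭-refl)) (↭ₚ.swap x z ↭ₚ.↭-refl)
  ∷ ↭ₚ.↭-trans (↭ₚ.↭-trans (↭ₚ.swap x y ↭ₚ.↭-refl) (↭ₚ.prep y (↭ₚ.swap x z ↭ₚ.↭-refl)))
      (↭ₚ.swap y z ↭ₚ.↭-refl)
  ∷ [])

-- F is a nonzero multiple of a member of Ls, so F does not vanish where they do not.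
Excluded : ∀ {d} → List (Form d) → Form d → Set
Excluded Ls F = Any (λ L → ∃ λ k → lookup F k ≢ 0ℤ × lookup L k ⊛ F ≡ lookup F k ⊛ L) Ls

excluded? : ∀ {d} (Ls : List (Form d)) F → Dec (Excluded Ls F)
excluded? Ls F = Any.any? (λ L → any? λ k →
  ¬? (lookup F k ℤ.≟ 0ℤ) ×-dec Vec.≡-dec ℤ._≟_ (lookup L k ⊛ F) (lookup F k ⊛ L)) Ls

module _ {k m d} (M : Fin k → Form d) (Ls : List (Form d)) (reps : Fin m → List (Fin k)) where

  -- If the colour c has the angle α + M c and none of Ls vanishes, then every
  -- triple of angles with sum 3α is listed in reps.
  OnlyReps : Set
  OnlyReps = ∀ a b c → (∃ λ e → reps e ∈ arrangements a b c) ⊎ Excluded Ls (M a ⊕ M b ⊕ M c)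

  onlyReps? : Dec OnlyReps
  onlyReps? = all? λ a → all? λ b → all? λ c →
    any? (λ e → reps e ∈? arrangements a b c) ⊎-dec excluded? Ls (M a ⊕ M b ⊕ M c)
    where open DecMembership (List.≡-dec _≟_) using (_∈?_)

-- Colouring the corners of an angled tiling

module AngledTilingProperties {c ℓ₁ ℓ₂} (K : OrderedField c ℓ₁ ℓ₂) where
  open Angles K renaming (refl to ≈-refl; sym to ≈-sym; trans to ≈-trans)
  open OrderedFieldProperties K
  open Solver using (solve; _:+_; _:*_; _:-_; :-_; con; _:=_)
  open MonoidMult +-monoid using (×-congʳ; ×-assocˡ)
  open Sums +-commutativeMonoid using (∑; ∑-↭; ∑-constant)
  open Setoid↭ setoid using (foldr-commMonoid)
  open Sums ℕ.+-0-commutativeMonoid using () renaming (∑-fibres to ℕ∑-fibres)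
  open import Relation.Binary.Reasoning.Setoid setoid

  map-pointwise : ∀ {a} {A : Set a} {f g : A → Carrier} xs → (∀ x → f x ≈ g x) → Pointwise _≈_ (map f xs) (map g xs)
  map-pointwise xs f≈g = Pointwise.map⁺ _ _ (Pointwise.refl (λ {x} → f≈g x))

  propositional⇒↭ : ∀ {a} {A : Set a} (f : A → Carrier) {xs ys} → xs ↭ₚ ys → map f xs ↭ map f ys
  propositional⇒↭ f xs↭ys = Homogeneous.map reflexive (↭ₚ.↭⇒↭ₛ (↭.map⁺ f xs↭ys))

  ∑-pointwise : ∀ {xs ys} → Pointwise _≈_ xs ys → ∑ xs ≈ ∑ ys
  ∑-pointwise []            = ≈-refl
  ∑-pointwise (x≈y ∷ xs≈ys) = +-cong x≈y (∑-pointwise xs≈ys)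

  -- Moves the rearrangement from values, known only up to `≈`, to their indices. There it is a
  -- propositional permutation, under which counts of colours are invariant.
  ↭-map⁻ : ∀ {k} (z : Fin k → Carrier) {xs ys cs} → xs ↭ ys → Pointwise (λ y c → y ≈ z c) ys cs →
           ∃ λ ds → Pointwise (λ x d → x ≈ z d) xs ds × ds ↭ₚ cs
  ↭-map⁻ z (refl xs≈ys)   ys≈cs = _ , Pointwise.transitive ≈-trans xs≈ys ys≈cs , ↭ₚ.↭-refl
  ↭-map⁻ z (prep x≈y p)   (y≈c ∷ ys≈cs) with ds , xs≈ds , ds↭cs ← ↭-map⁻ z p ys≈cs =
    _ , ≈-trans x≈y y≈c ∷ xs≈ds , ↭ₚ.prep _ ds↭cs
  ↭-map⁻ z (swap x≈ y≈ p) (y≈c ∷ x≈d ∷ ys≈cs) with ds , xs≈ds , ds↭cs ← ↭-map⁻ z p ys≈cs =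
    _ , ≈-trans x≈ x≈d ∷ ≈-trans y≈ y≈c ∷ xs≈ds , ↭ₚ.swap _ _ ds↭cs
  ↭-map⁻ z (trans p q)    zs≈cs
    with ds , ys≈ds , ds↭cs ← ↭-map⁻ z q zs≈cs
    with es , xs≈es , es↭ds ← ↭-map⁻ z p ys≈ds = es , xs≈es , ↭ₚ.↭-trans es↭ds ds↭cs

  pointwise-self : ∀ {k} (z : Fin k → Carrier) cs → Pointwise (λ y c → y ≈ z c) (map z cs) cs
  pointwise-self z []       = []
  pointwise-self z (c ∷ cs) = ≈-refl ∷ pointwise-self z cs

  -- For `i` and `j` equal this counts a single colour; that use determines the multiplicities
  -- later.
  within : ∀ {k} → Fin k → Fin k → Fin k → ℕ
  within i j c = indicator ((c ≟ i) ⊎-dec (c ≟ j))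

  module _ {π : Carrier} (α : Carrier) (3α≈2π : 3 · α ≈ 2 · π) (T : AngledTiling π 12) where
    open AngledTiling T
    open TilingProperties tiling
    open DoubleCount +-commutativeMonoid using (∑-vertices≈∑-tiles)

    -- A bijection of the sides that respects adjacency keeps or reverses their cyclic order. When
    -- it reverses, the corner between the sides i - 1 and i goes to the corner numbered by the
    -- image of i - 1, hence the composition with `rotation`.
    congruent⇒↭ : ∀ t t′ → AngleCongruent t t′ → tileAngles t ↭ tileAngles t′
    congruent⇒↭ t t′ (f , preserves) =
      [ (λ kept → corners f λ i →
          ≡.subst (λ j → angle (t , j) ≈ angle (t′ , f ⟨$⟩ʳ j)) (cyc∘cyc⁴ i) (kept (cyc⁴ i)))
      , (λ reversed → corners (rotation ∘ₚ f) λ i →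
          ≡.subst (λ j → angle (t , j) ≈ angle (t′ , f ⟨$⟩ʳ cyc⁴ i)) (cyc∘cyc⁴ i) (reversed (cyc⁴ i)))
      ]′ (keeps-or-reverses f (λ i → preserves i (cyc i) (angle (t , cyc i)) (inj₁ (≡.refl , ≈-refl))))
      where
      corners : (g : Permutation′ 5) → (∀ i → angle (t , i) ≈ angle (t′ , g ⟨$⟩ʳ i)) → tileAngles t ↭ tileAngles t′
      corners g eq = trans (refl (map-pointwise (allFin 5) eq))
        (propositional⇒↭ (λ i → angle (t′ , i)) (permute-allFin g))

    -- The total of all angles is twelve times the sum for one pentagon, and also 20 · 2π = 60α.
    pentagon-sum : ∀ {as} → PentagonAngles as → ∑ as ≈ 5 · α
    -- The factor cancelled is 12, the successor of the argument 11.
    pentagon-sum {as} pentagon = ·-cancelˡ 11 (begin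
      12 · ∑ as
        ≈⟨ ∑-constant (λ t → ∑ (tileAngles t)) (allFin 12) (λ t → foldr-commMonoid +-isCommutativeMonoid (pentagon t)) ⟨
      ∑ (map (λ t → ∑ (tileAngles t)) (allFin 12))
        ≈⟨ ∑-vertices≈∑-tiles angle ⟨
      ∑ (map (λ v → ∑ (anglesAt v)) (allFin V))
        ≈⟨ ∑-constant (λ v → ∑ (anglesAt v)) (allFin V) angle-sum ⟩
      length (allFin V) · (2 · π)
        ≡⟨ ≡.cong (_· (2 · π)) ∣V∣≡20 ⟩
      20 · (2 · π)
        ≈⟨ ×-congʳ 20 3α≈2π ⟨
      20 · (3 · α)
        ≈⟨ ×-assocˡ α 20 3 ⟩
      60 · α
        ≈⟨ ×-assocˡ α 12 5 ⟨
      12 · (5 · α) ∎)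

    -- A corner is coloured by the position c of its angle z c in the pattern.
    module Coloured {k} (z : Fin k → Carrier) (p : List (Fin k)) (pentagon : PentagonAngles (map z p)) where

      private
        -- In each tile a colour is used as often as in `p`, even if `z` takes equal values at
        -- different colours. This makes corner counts independent of coincidences among the angles.
        colouring : ∀ t → ∃ λ (f : Fin 5 → Fin k) → (∀ i → angle (t , i) ≈ z (f i)) × map f (allFin 5) ↭ₚ p
        colouring t with ↭-map⁻ z (pentagon t) (pointwise-self z p)
        ... | d₀ ∷ d₁ ∷ d₂ ∷ d₃ ∷ d₄ ∷ [] , e₀ ∷ e₁ ∷ e₂ ∷ e₃ ∷ e₄ ∷ [] , ds↭p =
          lookup (d₀ ∷ d₁ ∷ d₂ ∷ d₃ ∷ d₄ ∷ []) , (λ { 0F → e₀ ; 1F → e₁ ; 2F → e₂ ; 3F → e₃ ; 4F → e₄ }) , ds↭p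

      colour : Side 12 → Fin k
      colour (t , i) = proj₁ (colouring t) i

      angle≈ : ∀ s → angle s ≈ z (colour s)
      angle≈ (t , i) = proj₁ (proj₂ (colouring t)) i

      colours : Fin V → List (Fin k)
      colours v = map colour (cornersAt v)

      length-colours : ∀ v → length (colours v) ≡ 3
      length-colours v = ≡.trans (List.length-map colour (cornersAt v)) (degree≡3 v)

      anglesAt≈ : ∀ v → Pointwise _≈_ (anglesAt v) (map z (colours v))
      anglesAt≈ v = ≡.subst (Pointwise _≈_ (anglesAt v)) (List.map-∘ (cornersAt v)) (map-pointwise (cornersAt v) angle≈)

      full : ∀ v → ∑ (map z (colours v)) ≈ 3 · α
      full v = ≈-trans (∑-pointwise (Pointwise.symmetric ≈-sym (anglesAt≈ v))) (≈-trans (angle-sum v) (≈-sym 3α≈2π))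

      sum-colours : ∀ (w : Fin k → ℕ) → sum (map (λ v → sum (map w (colours v))) (allFin V)) ≡ 12 ℕ.* sum (map w p)
      sum-colours w = ≡.trans (≡.cong sum (List.map-cong (λ v → ≡.cong sum (≡.sym (List.map-∘ (cornersAt v)))) (allFin V)))
        (≡.trans (sum-vertices≡sum-tiles (w ∘ colour))
          (sum-constant (λ t → sum (map (λ i → w (colour (t , i))) (allFin 5))) _ (allFin 12)
            (All.universal (λ t → sum-↭ (↭.map⁺ w (proj₂ (proj₂ (colouring t))))) (allFin 12))))

      -- The corners coloured i or j are 24 > 20 in number, so two of them meet.
      full-with-two-of : ∀ i j → sum (map (within i j) p) ≡ 2 →
        ∃ λ r → ∑ (map z (i ∷ i ∷ r ∷ [])) ≈ 3 · α ⊎ ∑ (map z (i ∷ j ∷ r ∷ [])) ≈ 3 · α ⊎ ∑ (map z (j ∷ j ∷ r ∷ [])) ≈ 3 · α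
      full-with-two-of i j two =
        from-vertex (Any.satisfied (sum>⇒∃> (λ v → sum (map (within i j) (colours v))) 1 (allFin V) many))
        where
        many : length (allFin V) ℕ.* 1 ℕ.< sum (map (λ v → sum (map (within i j) (colours v))) (allFin V))
        many = ℕ.≤-trans (ℕ.≤-reflexive (≡.cong suc (≡.trans (ℕ.*-identityʳ _) ∣V∣≡20)))
          (ℕ.≤-trans (ℕ.m≤m+n 21 3) (ℕ.≤-reflexive (≡.sym (≡.trans (sum-colours (within i j)) (≡.cong (12 ℕ.*_) two)))))
        Full : Fin k → Fin k → Fin k → Set _
        Full a b c = ∑ (map z (a ∷ b ∷ c ∷ [])) ≈ 3 · α
        reorder : ∀ {a b c a′ b′ c′} → a ∷ b ∷ c ∷ [] ↭ₚ a′ ∷ b′ ∷ c′ ∷ [] → Full a b c → Full a′ b′ c′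
        reorder ↭′ f = ≈-trans (≈-sym (∑-↭ (↭.map⁺ z ↭′))) f
        from-pair : ∀ a b c → a ≡ i ⊎ a ≡ j → b ≡ i ⊎ b ≡ j → Full a b c → ∃ λ r → Full i i r ⊎ Full i j r ⊎ Full j j r
        from-pair a b c (inj₁ ≡.refl) (inj₁ ≡.refl) f = c , inj₁ f
        from-pair a b c (inj₁ ≡.refl) (inj₂ ≡.refl) f = c , inj₂ (inj₁ f)
        from-pair a b c (inj₂ ≡.refl) (inj₁ ≡.refl) f = c , inj₂ (inj₁ (reorder (↭ₚ.swap a b ↭ₚ.↭-refl) f))
        from-pair a b c (inj₂ ≡.refl) (inj₂ ≡.refl) f = c , inj₂ (inj₂ f)
        from-decs : ∀ {a b c} (a? : Dec (a ≡ i ⊎ a ≡ j)) (b? : Dec (b ≡ i ⊎ b ≡ j)) (c? : Dec (c ≡ i ⊎ c ≡ j)) → Full a b c →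
                    1 ℕ.< indicator a? ℕ.+ (indicator b? ℕ.+ (indicator c? ℕ.+ 0)) →
                    ∃ λ r → Full i i r ⊎ Full i j r ⊎ Full j j r
        from-decs {a} {b} {c} (yes pa) (yes pb) _        f _ = from-pair a b c pa pb f
        from-decs {a} {b} {c} (yes pa) (no _)   (yes pc) f _ =
          from-pair a c b pa pc (reorder (↭ₚ.prep a (↭ₚ.swap b c ↭ₚ.↭-refl)) f)
        from-decs {a} {b} {c} (no _)   (yes pb) (yes pc) f _ = from-pair b c a pb pc
          (reorder (↭ₚ.↭-trans (↭ₚ.swap a b ↭ₚ.↭-refl) (↭ₚ.prep b (↭ₚ.swap a c ↭ₚ.↭-refl))) f)
        from-decs (yes _) (no _)  (no _)  _ (ℕ.s≤s ())
        from-decs (no _)  (yes _) (no _)  _ (ℕ.s≤s ())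
        from-decs (no _)  (no _)  (yes _) _ (ℕ.s≤s ())
        from-list : ∀ cs → length cs ≡ 3 → ∑ (map z cs) ≈ 3 · α → 1 ℕ.< sum (map (within i j) cs) →
                    ∃ λ r → Full i i r ⊎ Full i j r ⊎ Full j j r
        from-list (a ∷ b ∷ c ∷ []) _ f = from-decs ((a ≟ i) ⊎-dec (a ≟ j)) ((b ≟ i) ⊎-dec (b ≟ j)) ((c ≟ i) ⊎-dec (c ≟ j)) f
        from-vertex : (∃ λ v → 1 ℕ.< sum (map (within i j) (colours v))) → ∃ λ r → Full i i r ⊎ Full i j r ⊎ Full j j r
        from-vertex (v , two≤) = from-list (colours v) (length-colours v) (full v) two≤

      -- The second component yields the equations for the multiplicities: constant weight 1 counts
      -- all 60 corners, an indicator counts those of one colour.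
      Census : ∀ {m} → (Fin m → List (Fin k)) → (Fin m → ℕ) → Set _
      Census {m} reps n =
        VertexCombination (map (λ e → n e , map z (reps e)) (allFin m)) ×
        (∀ (w : Fin k → ℕ) → sum (map (λ e → n e ℕ.* sum (map w (reps e))) (allFin m)) ≡ 12 ℕ.* sum (map w p))

      module _ {m} (reps : Fin m → List (Fin k)) (classify : ∀ v → ∃ λ e → colours v ↭ₚ reps e) where

        class : Fin V → Fin m
        class v = proj₁ (classify v)

        members : Fin m → List (Fin V)
        members = fibre class (allFin V)

        multiplicity : Fin m → ℕ
        multiplicity e = length (members e)

        private
          in-class : ∀ e → All (λ v → class v ≡ e) (members e)
          in-class e = All.all-filter (λ v → class v ≟ e) (allFin V)

          anglesAt↭ : ∀ v → anglesAt v ↭ map z (reps (class v))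
          anglesAt↭ v = trans (refl (anglesAt≈ v)) (propositional⇒↭ z (proj₂ (classify v)))

          replicated : ∀ e vs → All (λ v → class v ≡ e) vs →
                       Pointwise _↭_ (map anglesAt vs) (replicate (length vs) (map z (reps e)))
          replicated e []       []              = []
          replicated e (v ∷ vs) (≡.refl ∷ vs∈e) = anglesAt↭ v ∷ replicated e vs vs∈e

          listing : List (Fin m) → List (List Carrier)
          listing es = concatMap (uncurry replicate) (map (λ e → multiplicity e , map z (reps e)) es)

          listed : ∀ es → Pointwise _↭_ (map anglesAt (concat (map members es))) (listing es)
          listed []       = []
          listed (e ∷ es) = ≡.subst (λ l → Pointwise _↭_ l (listing (e ∷ es))) (≡.sym (List.map-++ anglesAt (members e) _))
            (Pointwise.++⁺ {R = _↭_} (replicated e (members e) (in-class e)) (listed es))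

        vertexCombination : VertexCombination (map (λ e → multiplicity e , map z (reps e)) (allFin m))
        vertexCombination = trans
          (Homogeneous.map (λ { ≡.refl → refl (Pointwise.refl ≈-refl) })
            (↭ₚ.↭⇒↭ₛ (↭.map⁺ anglesAt (↭ₚ.↭-sym (concat-fibres class (allFin V))))))
          (refl (listed (allFin m)))

        corner-count : ∀ (w : Fin k → ℕ) →
          sum (map (λ e → multiplicity e ℕ.* sum (map w (reps e))) (allFin m)) ≡ 12 ℕ.* sum (map w p)
        corner-count w = ≡.trans
          (≡.cong sum (List.map-cong (λ e → ≡.sym (sum-constant _ _ (members e)
            (All.map (λ {v} v∈e → ≡.trans (sum-↭ (↭.map⁺ w (proj₂ (classify v)))) (≡.cong (λ e → sum (map w (reps e))) v∈e))
              (in-class e)))) (allFin m)))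
          (≡.trans (ℕ∑-fibres class (λ v → sum (map w (colours v))) (allFin V)) (sum-colours w))

        census : ∃ (Census reps)
        census = multiplicity , vertexCombination , corner-count

      -- At a vertex the three deviations from α sum to zero, so the sum of their forms vanishes at
      -- `ts`. This is impossible for an excluded triple, and `only` lists all others.
      classified : ∀ {m d} (M : Fin k → Form d) (Ls : List (Form d)) (reps : Fin m → List (Fin k)) (ts : Vec Carrier d) →
        (∀ c → z c ≈ α + ⟦ M c ⟧ ts) → All (λ L → ¬ ⟦ L ⟧ ts ≈ 0#) Ls → OnlyReps M Ls reps →
        ∀ v → ∃ λ e → colours v ↭ₚ reps e
      classified M Ls reps ts z≈ Ls≉0 only v = from-list (colours v) (length-colours v) (full v)
        where
        vanishes : ∀ a b c → ∑ (map z (a ∷ b ∷ c ∷ [])) ≈ 3 · α → ⟦ M a ⊕ M b ⊕ M c ⟧ ts ≈ 0#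
        vanishes a b c f = begin
          ⟦ M a ⊕ M b ⊕ M c ⟧ ts
            ≈⟨ ≈-trans (⟦⊕⟧ (M a ⊕ M b) (M c) ts) (+-congʳ (⟦⊕⟧ (M a) (M b) ts)) ⟩
          ⟦ M a ⟧ ts + ⟦ M b ⟧ ts + ⟦ M c ⟧ ts
            ≈⟨ solve 4 (λ α a b c →
                 a :+ b :+ c := (α :+ a) :+ ((α :+ b) :+ ((α :+ c) :+ con 0ℤ)) :- 3 :· α) ≈-refl α _ _ _ ⟩
          (α + ⟦ M a ⟧ ts) + ((α + ⟦ M b ⟧ ts) + ((α + ⟦ M c ⟧ ts) + 0#)) - 3 · α
            ≈⟨ +-congʳ (+-cong (z≈ a) (+-cong (z≈ b) (+-congʳ (z≈ c)))) ⟨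
          ∑ (map z (a ∷ b ∷ c ∷ [])) - 3 · α
            ≈⟨ x≈y⇒x-y≈0 f ⟩
          0# ∎
        not-excluded : ∀ F → ⟦ F ⟧ ts ≈ 0# → ¬ Excluded Ls F
        not-excluded F F≈0 = All.lookupWith (λ {L} L≉0 (k , Fₖ≢0 , eq) → L≉0 (ι*-cancel (lookup F k) Fₖ≢0 (begin
          ι (lookup F k) * ⟦ L ⟧ ts   ≈⟨ ⟦⊛⟧ (lookup F k) L ts ⟨
          ⟦ lookup F k ⊛ L ⟧ ts       ≡⟨ ≡.cong (λ G → ⟦ G ⟧ ts) eq ⟨
          ⟦ lookup L k ⊛ F ⟧ ts       ≈⟨ ⟦⊛⟧ (lookup L k) F ts ⟩
          ι (lookup L k) * ⟦ F ⟧ ts   ≈⟨ ≈-trans (*-congˡ F≈0) (zeroʳ _) ⟩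
          0#                          ∎))) Ls≉0
        from-list : ∀ cs → length cs ≡ 3 → ∑ (map z cs) ≈ 3 · α → ∃ λ e → cs ↭ₚ reps e
        from-list (a ∷ b ∷ c ∷ []) _ f with only a b c
        ... | inj₁ (e , e∈) = e , arrangements-↭ a b c e∈
        ... | inj₂ excluded = contradiction excluded (not-excluded _ (vanishes a b c f))

-- The five configurations

module Counting where

  one-class : ∀ n → n ℕ.* 3 ℕ.+ 0 ≡ 60 → n ≡ 20
  one-class n eq = ℕ.*-cancelʳ-≡ n 20 3 (≡.trans (≡.sym (ℕ.+-identityʳ _)) eq)

  -- The first equation counts an angle that occurs once in the pentagon, once at each vertex of the
  -- second kind and never at the first; the second counts all corners. The products with 0 and 1
  -- are kept so that the equations of a census fit by computation.
  two-classes : ∀ m n → m ℕ.* 0 ℕ.+ (n ℕ.* 1 ℕ.+ 0) ≡ 12 → m ℕ.* 3 ℕ.+ (n ℕ.* 3 ℕ.+ 0) ≡ 60 → m ≡ 8 × n ≡ 12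
  two-classes m n eq₁ eq₂ =
    ℕ.*-cancelʳ-≡ m 8 3 (ℕ.+-cancelʳ-≡ 36 (m ℕ.* 3) 24
      (≡.subst (λ n → m ℕ.* 3 ℕ.+ (n ℕ.* 3 ℕ.+ 0) ≡ 60) n≡12 eq₂)) , n≡12
    where
    n-alone : ∀ m n → m ℕ.* 0 ℕ.+ (n ℕ.* 1 ℕ.+ 0) ≡ n
    n-alone = solve-∀
    n≡12 : n ≡ 12
    n≡12 = ≡.trans (≡.sym (n-alone m n)) eq₁

  -- The equations count the corners α, β, γ and ε. Adding 3n₃ to the first and inserting the next
  -- two gives 12 + 3n₃ = 3n₀ + 24, hence n₃ = 4 + n₀; the others follow. As n₁ = 12 - 2n₃ cannot be
  -- negative, n₀ is at most 2.
  five-classes : ∀ n₀ n₁ n₂ n₃ n₄ →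
    n₀ ℕ.* 3 ℕ.+ (n₁ ℕ.* 1 ℕ.+ (n₂ ℕ.* 1 ℕ.+ (n₃ ℕ.* 0 ℕ.+ (n₄ ℕ.* 0 ℕ.+ 0)))) ≡ 12 →
    n₀ ℕ.* 0 ℕ.+ (n₁ ℕ.* 1 ℕ.+ (n₂ ℕ.* 0 ℕ.+ (n₃ ℕ.* 2 ℕ.+ (n₄ ℕ.* 0 ℕ.+ 0)))) ≡ 12 →
    n₀ ℕ.* 0 ℕ.+ (n₁ ℕ.* 0 ℕ.+ (n₂ ℕ.* 1 ℕ.+ (n₃ ℕ.* 1 ℕ.+ (n₄ ℕ.* 0 ℕ.+ 0)))) ≡ 12 →
    n₀ ℕ.* 0 ℕ.+ (n₁ ℕ.* 0 ℕ.+ (n₂ ℕ.* 1 ℕ.+ (n₃ ℕ.* 0 ℕ.+ (n₄ ℕ.* 1 ℕ.+ 0)))) ≡ 12 →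
    ∃ λ m → (m ≡ 0 ⊎ m ≡ 1 ⊎ m ≡ 2) × n₀ ≡ m × n₁ ≡ 4 ℕ.∸ 2 ℕ.* m × n₂ ≡ 8 ℕ.∸ m × n₃ ≡ 4 ℕ.+ m × n₄ ≡ 4 ℕ.+ m
  five-classes n₀ n₁ n₂ n₃ n₄ α β γ ε = cases n₀ ≡.refl
    where
    sum-identity : ∀ n₀ n₁ n₂ n₃ n₄ →
      (n₀ ℕ.* 3 ℕ.+ (n₁ ℕ.* 1 ℕ.+ (n₂ ℕ.* 1 ℕ.+ (n₃ ℕ.* 0 ℕ.+ (n₄ ℕ.* 0 ℕ.+ 0))))) ℕ.+ n₃ ℕ.* 3
      ≡ n₀ ℕ.* 3 ℕ.+ (n₀ ℕ.* 0 ℕ.+ (n₁ ℕ.* 1 ℕ.+ (n₂ ℕ.* 0 ℕ.+ (n₃ ℕ.* 2 ℕ.+ (n₄ ℕ.* 0 ℕ.+ 0))))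
          ℕ.+ (n₀ ℕ.* 0 ℕ.+ (n₁ ℕ.* 0 ℕ.+ (n₂ ℕ.* 1 ℕ.+ (n₃ ℕ.* 1 ℕ.+ (n₄ ℕ.* 0 ℕ.+ 0))))))
    sum-identity = solve-∀
    shift12 : ∀ n → n ℕ.* 3 ℕ.+ 24 ≡ 12 ℕ.+ (4 ℕ.+ n) ℕ.* 3
    shift12 = solve-∀
    n₃≡ : n₃ ≡ 4 ℕ.+ n₀
    n₃≡ = ℕ.*-cancelʳ-≡ n₃ (4 ℕ.+ n₀) 3 (ℕ.+-cancelˡ-≡ 12 _ _ (≡.trans
      (≡.trans (≡.cong (ℕ._+ n₃ ℕ.* 3) (≡.sym α)) (≡.trans (sum-identity n₀ n₁ n₂ n₃ n₄)
        (≡.cong₂ (λ x y → n₀ ℕ.* 3 ℕ.+ (x ℕ.+ y)) β γ))) (shift12 n₀)))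
    n₂+n₃ : n₂ ℕ.+ n₃ ≡ 12
    n₂+n₃ = ≡.trans (≡.sym (lemma n₀ n₁ n₂ n₃ n₄)) γ
      where
      lemma : ∀ n₀ n₁ n₂ n₃ n₄ → n₀ ℕ.* 0 ℕ.+ (n₁ ℕ.* 0 ℕ.+ (n₂ ℕ.* 1 ℕ.+ (n₃ ℕ.* 1 ℕ.+ (n₄ ℕ.* 0 ℕ.+ 0)))) ≡ n₂ ℕ.+ n₃
      lemma = solve-∀
    n₂+n₄ : n₂ ℕ.+ n₄ ≡ 12
    n₂+n₄ = ≡.trans (≡.sym (lemma n₀ n₁ n₂ n₃ n₄)) ε
      where
      lemma : ∀ n₀ n₁ n₂ n₃ n₄ → n₀ ℕ.* 0 ℕ.+ (n₁ ℕ.* 0 ℕ.+ (n₂ ℕ.* 1 ℕ.+ (n₃ ℕ.* 0 ℕ.+ (n₄ ℕ.* 1 ℕ.+ 0)))) ≡ n₂ ℕ.+ n₄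
      lemma = solve-∀
    n₁+2n₃ : n₁ ℕ.+ n₃ ℕ.* 2 ≡ 12
    n₁+2n₃ = ≡.trans (≡.sym (lemma n₀ n₁ n₂ n₃ n₄)) β
      where
      lemma : ∀ n₀ n₁ n₂ n₃ n₄ → n₀ ℕ.* 0 ℕ.+ (n₁ ℕ.* 1 ℕ.+ (n₂ ℕ.* 0 ℕ.+ (n₃ ℕ.* 2 ℕ.+ (n₄ ℕ.* 0 ℕ.+ 0)))) ≡ n₁ ℕ.+ n₃ ℕ.* 2
      lemma = solve-∀
    n₄≡ : n₄ ≡ 4 ℕ.+ n₀
    n₄≡ = ≡.trans (ℕ.+-cancelˡ-≡ n₂ n₄ n₃ (≡.trans n₂+n₄ (≡.sym n₂+n₃))) n₃≡
    n₁≡ : n₁ ≡ 12 ℕ.∸ (4 ℕ.+ n₀) ℕ.* 2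
    n₁≡ = ≡.trans (≡.sym (ℕ.m+n∸n≡m n₁ (n₃ ℕ.* 2))) (≡.cong₂ (λ x y → x ℕ.∸ y ℕ.* 2) n₁+2n₃ n₃≡)
    n₂≡ : n₂ ≡ 12 ℕ.∸ (4 ℕ.+ n₀)
    n₂≡ = ≡.trans (≡.sym (ℕ.m+n∸n≡m n₂ n₃)) (≡.cong₂ ℕ._∸_ n₂+n₃ n₃≡)
    2n₃≤12 : n₃ ℕ.* 2 ℕ.≤ 12
    2n₃≤12 = ℕ.≤-trans (ℕ.m≤n+m (n₃ ℕ.* 2) n₁) (ℕ.≤-reflexive n₁+2n₃)
    cases : ∀ m → n₀ ≡ m →
            ∃ λ m → (m ≡ 0 ⊎ m ≡ 1 ⊎ m ≡ 2) × n₀ ≡ m × n₁ ≡ 4 ℕ.∸ 2 ℕ.* m × n₂ ≡ 8 ℕ.∸ m × n₃ ≡ 4 ℕ.+ m × n₄ ≡ 4 ℕ.+ m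
    cases 0 ≡.refl = 0 , inj₁ ≡.refl , ≡.refl , n₁≡ , n₂≡ , n₃≡ , n₄≡
    cases 1 ≡.refl = 1 , inj₂ (inj₁ ≡.refl) , ≡.refl , n₁≡ , n₂≡ , n₃≡ , n₄≡
    cases 2 ≡.refl = 2 , inj₂ (inj₂ ≡.refl) , ≡.refl , n₁≡ , n₂≡ , n₃≡ , n₄≡
    -- Here `n₃` is at least 7, but each β²γ-vertex takes two of the twelve β-corners.
    cases (suc (suc (suc m))) ≡.refl = contradiction
      (ℕ.≤-trans (ℕ.*-monoˡ-≤ 2 {x = 7} (ℕ.≤-trans (ℕ.m≤m+n 7 m) (ℕ.≤-reflexive (≡.sym n₃≡)))) 2n₃≤12)
      (ℕ.<⇒≱ (ℕ.m≤m+n 13 1))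

-- Deviations from α and the vertices they allow

along : ∀ {k} → Vec ℤ k → Fin k → Form 1
along offsets c = lookup offsets c ∷ []

unit : List (Form 1)
unit = (1ℤ ∷ []) ∷ []

reps₁ : Fin 1 → List (Fin 1)
reps₁ _ = 0F ∷ 0F ∷ 0F ∷ []

only₁ : OnlyReps (λ _ → []) [] reps₁
only₁ = toWitness {a? = onlyReps? (λ _ → []) [] reps₁} _

offsets₂ : Vec ℤ 3
offsets₂ = 0ℤ ∷ 1ℤ ∷ -1ℤ ∷ []

reps₂ : Fin 2 → List (Fin 3)
reps₂ = lookup ((0F ∷ 0F ∷ 0F ∷ []) ∷ (0F ∷ 1F ∷ 2F ∷ []) ∷ [])

only₂ : OnlyReps (along offsets₂) unit reps₂
only₂ = toWitness {a? = onlyReps? (along offsets₂) unit reps₂} _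

offsets₃ : Vec ℤ 3
offsets₃ = 0ℤ ∷ 1ℤ ∷ ℤ.- + 2 ∷ []

reps₃ : Fin 2 → List (Fin 3)
reps₃ = lookup ((0F ∷ 0F ∷ 0F ∷ []) ∷ (1F ∷ 1F ∷ 2F ∷ []) ∷ [])

only₃ : OnlyReps (along offsets₃) unit reps₃
only₃ = toWitness {a? = onlyReps? (along offsets₃) unit reps₃} _

offsets₄ : Fin 4 → Form 2
offsets₄ = lookup ((0ℤ ∷ 0ℤ ∷ []) ∷ (1ℤ ∷ 0ℤ ∷ []) ∷ (0ℤ ∷ 1ℤ ∷ []) ∷ (-1ℤ ∷ -1ℤ ∷ []) ∷ [])

difference₄ : Fin 4 → Fin 4 → Form 2
difference₄ a b = offsets₄ a ⊕ -1ℤ ⊛ offsets₄ b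

differences₄ : List (Form 2)
differences₄ =
  difference₄ 0F 1F ∷ difference₄ 0F 2F ∷ difference₄ 0F 3F ∷
  difference₄ 1F 2F ∷ difference₄ 1F 3F ∷ difference₄ 2F 3F ∷ []

reps₄ : Fin 2 → List (Fin 4)
reps₄ = lookup ((0F ∷ 0F ∷ 0F ∷ []) ∷ (1F ∷ 2F ∷ 3F ∷ []) ∷ [])

-- Any other triple with sum 3α makes two of the four angles equal; for example 2β + γ = 3α gives β
-- = δ.
only₄ : OnlyReps offsets₄ differences₄ reps₄
only₄ = toWitness {a? = onlyReps? offsets₄ differences₄ reps₄} _

offsets₅ : Vec ℤ 5
offsets₅ = 0ℤ ∷ 1ℤ ∷ ℤ.- + 2 ∷ -1ℤ ∷ + 2 ∷ []

reps₅ : Fin 5 → List (Fin 5)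
reps₅ = lookup
  ( (0F ∷ 0F ∷ 0F ∷ []) ∷ (0F ∷ 1F ∷ 3F ∷ []) ∷ (0F ∷ 2F ∷ 4F ∷ [])
  ∷ (1F ∷ 1F ∷ 2F ∷ []) ∷ (3F ∷ 3F ∷ 4F ∷ []) ∷ [])

only₅ : OnlyReps (along offsets₅) unit reps₅
only₅ = toWitness {a? = onlyReps? (along offsets₅) unit reps₅} _

-- Vertex combinations of the five patterns

module Configurations {c ℓ₁ ℓ₂} (K : OrderedField c ℓ₁ ℓ₂) where
  open Angles K renaming (refl to ≈-refl; sym to ≈-sym; trans to ≈-trans)
  open OrderedFieldProperties K
  open AngledTilingProperties K
  open Solver using (solve; _:+_; _:*_; _:-_; :-_; con; _:=_)
  open Counting
  open import Relation.Binary.Reasoning.Setoid setoid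

  offsets-distinct : ∀ {α t x y} m n → ¬ t ≈ 0# → x ≈ α + ⟦ m ∷ [] ⟧ (t ∷ []) → y ≈ α + ⟦ n ∷ [] ⟧ (t ∷ []) →
                     m ℤ.- n ≢ 0ℤ → ¬ x ≈ y
  offsets-distinct {α} {t} {x} {y} m n t≉0 x≈ y≈ m-n≢0 x≈y = t≉0 (ι*-cancel (m ℤ.- n) m-n≢0 (begin
    ι (m ℤ.- n) * t                                       ≈⟨ *-congʳ (≈-trans (ι-+ m (ℤ.- n)) (+-congˡ (ι-neg n))) ⟩
    (ι m - ι n) * t
      ≈⟨ solve 4 (λ α m n t →
           (m :- n) :* t := (α :+ (m :* t :+ con 0ℤ)) :- (α :+ (n :* t :+ con 0ℤ))) ≈-refl α (ι m) (ι n) t ⟩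
    (α + ⟦ m ∷ [] ⟧ (t ∷ [])) - (α + ⟦ n ∷ [] ⟧ (t ∷ [])) ≈⟨ +-cong x≈ (-‿cong y≈) ⟨
    x - y                                                 ≈⟨ x≈y⇒x-y≈0 x≈y ⟩
    0#                                                    ∎))

  unit-nonzero : ∀ {t} → ¬ t ≈ 0# → All (λ L → ¬ ⟦ L ⟧ (t ∷ []) ≈ 0#) ((1ℤ ∷ []) ∷ [])
  unit-nonzero {t} t≉0 = (λ t≈0 → t≉0 (≈-trans (solve 1 (λ t → t := con 1ℤ :* t :+ con 0ℤ) ≈-refl t) t≈0)) ∷ []

  module _ {π : Carrier} (α : Carrier) (3α≈2π : 3 · α ≈ 2 · π) (T : AngledTiling π 12) where
    open AngledTiling T using (PentagonAngles; VertexCombination)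

    with-two-classes : ∀ {as bs} m n → m ℕ.* 0 ℕ.+ (n ℕ.* 1 ℕ.+ 0) ≡ 12 → m ℕ.* 3 ℕ.+ (n ℕ.* 3 ℕ.+ 0) ≡ 60 →
                       VertexCombination ((m , as) ∷ (n , bs) ∷ []) → VertexCombination ((8 , as) ∷ (12 , bs) ∷ [])
    with-two-classes {as} {bs} m n eq₁ eq₂ = ≡.subst₂ (λ m n → VertexCombination ((m , as) ∷ (n , bs) ∷ []))
      (proj₁ (two-classes m n eq₁ eq₂)) (proj₂ (two-classes m n eq₁ eq₂))

    α⁵ : PentagonAngles (α ∷ α ∷ α ∷ α ∷ α ∷ []) → VertexCombination ((20 , α ∷ α ∷ α ∷ []) ∷ [])
    α⁵ pentagon = finish (census reps₁ (classified (λ _ → []) [] reps₁ [] (λ { 0F → ≈-sym (+-identityʳ α) }) [] only₁))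
      where
      open Coloured α 3α≈2π T (lookup (α ∷ [])) (0F ∷ 0F ∷ 0F ∷ 0F ∷ 0F ∷ []) pentagon
      finish : ∃ (Census reps₁) → VertexCombination ((20 , α ∷ α ∷ α ∷ []) ∷ [])
      finish (n , combination , count) =
        ≡.subst (λ n → VertexCombination ((n , _) ∷ [])) (one-class (n 0F) (count (λ _ → 1))) combination

    α³βγ : ∀ {β γ} → PentagonAngles (α ∷ α ∷ α ∷ β ∷ γ ∷ []) → ¬ β ≈ α → β + γ ≈ 2 · α →
           Unique (α ∷ β ∷ γ ∷ []) × VertexCombination ((8 , α ∷ α ∷ α ∷ []) ∷ (12 , α ∷ β ∷ γ ∷ []) ∷ [])
    α³βγ {β} {γ} pentagon β≉α β+γ≈2α
      = (distinct 0F 1F (λ ()) ∷ distinct 0F 2F (λ ()) ∷ []) ∷ (distinct 1F 2F (λ ()) ∷ []) ∷ [] ∷ []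
      , finish (census reps₂ (classified (along offsets₂) unit reps₂ (β - α ∷ []) z≈ (unit-nonzero t≉0) only₂))
      where
      z = lookup (α ∷ β ∷ γ ∷ [])
      t≉0 : ¬ β - α ≈ 0#
      t≉0 = β≉α ∘ x-y≈0⇒x≈y
      z≈ : ∀ c → z c ≈ α + ⟦ along offsets₂ c ⟧ (β - α ∷ [])
      z≈ 0F = solve 2 (λ α β → α := α :+ (con 0ℤ :* (β :- α) :+ con 0ℤ)) ≈-refl α β
      z≈ 1F = solve 2 (λ α β → β := α :+ (con 1ℤ :* (β :- α) :+ con 0ℤ)) ≈-refl α β
      z≈ 2F = begin
        γ                                     ≈⟨ solve 2 (λ β γ → γ := β :+ γ :- β) ≈-refl β γ ⟩
        β + γ - β                             ≈⟨ +-congʳ β+γ≈2α ⟩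
        2 · α - β
          ≈⟨ solve 2 (λ α β → 2 :· α :- β := α :+ (con -1ℤ :* (β :- α) :+ con 0ℤ)) ≈-refl α β ⟩
        α + (ι -1ℤ * (β - α) + 0#)            ∎
      distinct : ∀ a b → lookup offsets₂ a ℤ.- lookup offsets₂ b ≢ 0ℤ → ¬ z a ≈ z b
      distinct a b = offsets-distinct (lookup offsets₂ a) (lookup offsets₂ b) t≉0 (z≈ a) (z≈ b)
      open Coloured α 3α≈2π T z (0F ∷ 0F ∷ 0F ∷ 1F ∷ 2F ∷ []) pentagon
      finish : ∃ (Census reps₂) → VertexCombination ((8 , α ∷ α ∷ α ∷ []) ∷ (12 , α ∷ β ∷ γ ∷ []) ∷ [])
      finish (n , combination , count) =
        with-two-classes (n 0F) (n 1F) (count (within 2F 2F)) (count (λ _ → 1)) combination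

    α²β²γ : ∀ {β γ} → PentagonAngles (α ∷ α ∷ β ∷ β ∷ γ ∷ []) → ¬ β ≈ α → 2 · β + γ ≈ 3 · α →
            Unique (α ∷ β ∷ γ ∷ []) × VertexCombination ((8 , α ∷ α ∷ α ∷ []) ∷ (12 , β ∷ β ∷ γ ∷ []) ∷ [])
    α²β²γ {β} {γ} pentagon β≉α 2β+γ≈3α
      = (distinct 0F 1F (λ ()) ∷ distinct 0F 2F (λ ()) ∷ []) ∷ (distinct 1F 2F (λ ()) ∷ []) ∷ [] ∷ []
      , finish (census reps₃ (classified (along offsets₃) unit reps₃ (β - α ∷ []) z≈ (unit-nonzero t≉0) only₃))
      where
      z = lookup (α ∷ β ∷ γ ∷ [])
      t≉0 : ¬ β - α ≈ 0#
      t≉0 = β≉α ∘ x-y≈0⇒x≈y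
      z≈ : ∀ c → z c ≈ α + ⟦ along offsets₃ c ⟧ (β - α ∷ [])
      z≈ 0F = solve 2 (λ α β → α := α :+ (con 0ℤ :* (β :- α) :+ con 0ℤ)) ≈-refl α β
      z≈ 1F = solve 2 (λ α β → β := α :+ (con 1ℤ :* (β :- α) :+ con 0ℤ)) ≈-refl α β
      z≈ 2F = begin
        γ                                     ≈⟨ solve 2 (λ β γ → γ := 2 :· β :+ γ :- 2 :· β) ≈-refl β γ ⟩
        2 · β + γ - 2 · β                     ≈⟨ +-congʳ 2β+γ≈3α ⟩
        3 · α - 2 · β
          ≈⟨ solve 2 (λ α β → 3 :· α :- 2 :· β := α :+ (con (ℤ.- + 2) :* (β :- α) :+ con 0ℤ)) ≈-refl α β ⟩
        α + (ι (ℤ.- + 2) * (β - α) + 0#)      ∎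
      distinct : ∀ a b → lookup offsets₃ a ℤ.- lookup offsets₃ b ≢ 0ℤ → ¬ z a ≈ z b
      distinct a b = offsets-distinct (lookup offsets₃ a) (lookup offsets₃ b) t≉0 (z≈ a) (z≈ b)
      open Coloured α 3α≈2π T z (0F ∷ 0F ∷ 1F ∷ 1F ∷ 2F ∷ []) pentagon
      finish : ∃ (Census reps₃) → VertexCombination ((8 , α ∷ α ∷ α ∷ []) ∷ (12 , β ∷ β ∷ γ ∷ []) ∷ [])
      finish (n , combination , count) =
        with-two-classes (n 0F) (n 1F) (count (within 2F 2F)) (count (λ _ → 1)) combination

    -- Distinctness is assumed here: β - α and γ - α are both free, so each coincidence has to be
    -- excluded separately. In the one-parameter patterns it follows from β ≠ α.
    α²βγδ : ∀ {β γ δ} → PentagonAngles (α ∷ α ∷ β ∷ γ ∷ δ ∷ []) → Unique (α ∷ β ∷ γ ∷ δ ∷ []) → β + γ + δ ≈ 3 · α →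
            VertexCombination ((8 , α ∷ α ∷ α ∷ []) ∷ (12 , β ∷ γ ∷ δ ∷ []) ∷ [])
    α²βγδ {β} {γ} {δ} pentagon ((α≉β ∷ α≉γ ∷ α≉δ ∷ []) ∷ (β≉γ ∷ β≉δ ∷ []) ∷ (γ≉δ ∷ []) ∷ _) β+γ+δ≈3α =
      finish (census reps₄ (classified offsets₄ differences₄ reps₄ ts z≈
        ( distinct 0F 1F α≉β ∷ distinct 0F 2F α≉γ ∷ distinct 0F 3F α≉δ
        ∷ distinct 1F 2F β≉γ ∷ distinct 1F 3F β≉δ ∷ distinct 2F 3F γ≉δ ∷ []) only₄))
      where
      z = lookup (α ∷ β ∷ γ ∷ δ ∷ [])
      ts = β - α ∷ γ - α ∷ []
      z≈ : ∀ c → z c ≈ α + ⟦ offsets₄ c ⟧ ts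
      z≈ 0F = solve 3 (λ α β γ → α := α :+ (con 0ℤ :* (β :- α) :+ (con 0ℤ :* (γ :- α) :+ con 0ℤ))) ≈-refl α β γ
      z≈ 1F = solve 3 (λ α β γ → β := α :+ (con 1ℤ :* (β :- α) :+ (con 0ℤ :* (γ :- α) :+ con 0ℤ))) ≈-refl α β γ
      z≈ 2F = solve 3 (λ α β γ → γ := α :+ (con 0ℤ :* (β :- α) :+ (con 1ℤ :* (γ :- α) :+ con 0ℤ))) ≈-refl α β γ
      z≈ 3F = begin
        δ                                     ≈⟨ solve 3 (λ β γ δ → δ := β :+ γ :+ δ :- (β :+ γ)) ≈-refl β γ δ ⟩
        β + γ + δ - (β + γ)                   ≈⟨ +-congʳ β+γ+δ≈3α ⟩
        3 · α - (β + γ)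
          ≈⟨ solve 3 (λ α β γ →
               3 :· α :- (β :+ γ) := α :+ (con -1ℤ :* (β :- α) :+ (con -1ℤ :* (γ :- α) :+ con 0ℤ))) ≈-refl α β γ ⟩
        α + ⟦ offsets₄ 3F ⟧ ts                ∎
      distinct : ∀ a b → ¬ z a ≈ z b → ¬ ⟦ difference₄ a b ⟧ ts ≈ 0#
      distinct a b a≉b a-b≈0 = a≉b (x-y≈0⇒x≈y (begin
        z a - z b                                       ≈⟨ +-cong (z≈ a) (-‿cong (z≈ b)) ⟩
        (α + ⟦ offsets₄ a ⟧ ts) - (α + ⟦ offsets₄ b ⟧ ts)
          ≈⟨ solve 3 (λ α a b → (α :+ a) :- (α :+ b) := a :+ con -1ℤ :* b) ≈-refl α _ _ ⟩
        ⟦ offsets₄ a ⟧ ts + ι -1ℤ * ⟦ offsets₄ b ⟧ ts   ≈⟨ +-congˡ (⟦⊛⟧ -1ℤ (offsets₄ b) ts) ⟨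
        ⟦ offsets₄ a ⟧ ts + ⟦ -1ℤ ⊛ offsets₄ b ⟧ ts     ≈⟨ ⟦⊕⟧ (offsets₄ a) (-1ℤ ⊛ offsets₄ b) ts ⟨
        ⟦ difference₄ a b ⟧ ts                          ≈⟨ a-b≈0 ⟩
        0#                                              ∎))
      open Coloured α 3α≈2π T z (0F ∷ 0F ∷ 1F ∷ 2F ∷ 3F ∷ []) pentagon
      finish : ∃ (Census reps₄) → VertexCombination ((8 , α ∷ α ∷ α ∷ []) ∷ (12 , β ∷ γ ∷ δ ∷ []) ∷ [])
      finish (n , combination , count) =
        with-two-classes (n 0F) (n 1F) (count (within 3F 3F)) (count (λ _ → 1)) combination

    αβγδε : ∀ {β γ δ ε} → PentagonAngles (α ∷ β ∷ γ ∷ δ ∷ ε ∷ []) → ¬ β ≈ α →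
            γ ≈ 3 · α - 2 · β → δ ≈ 2 · α - β → ε ≈ 2 · β - α →
            Unique (α ∷ β ∷ γ ∷ δ ∷ ε ∷ [])
          × ( VertexCombination
                ( (4 , α ∷ β ∷ δ ∷ []) ∷ (8 , α ∷ γ ∷ ε ∷ [])
                ∷ (4 , β ∷ β ∷ γ ∷ []) ∷ (4 , δ ∷ δ ∷ ε ∷ []) ∷ [] )
            ⊎ VertexCombination
                ( (1 , α ∷ α ∷ α ∷ []) ∷ (2 , α ∷ β ∷ δ ∷ []) ∷ (7 , α ∷ γ ∷ ε ∷ [])
                ∷ (5 , β ∷ β ∷ γ ∷ []) ∷ (5 , δ ∷ δ ∷ ε ∷ []) ∷ [] )
            ⊎ VertexCombination
                ( (2 , α ∷ α ∷ α ∷ []) ∷ (6 , α ∷ γ ∷ ε ∷ [])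
                ∷ (6 , β ∷ β ∷ γ ∷ []) ∷ (6 , δ ∷ δ ∷ ε ∷ []) ∷ [] ) )
    αβγδε {β} {γ} {δ} {ε} pentagon β≉α γ≈ δ≈ ε≈
      = (distinct 0F 1F (λ ()) ∷ distinct 0F 2F (λ ()) ∷ distinct 0F 3F (λ ()) ∷ distinct 0F 4F (λ ()) ∷ [])
      ∷ (distinct 1F 2F (λ ()) ∷ distinct 1F 3F (λ ()) ∷ distinct 1F 4F (λ ()) ∷ [])
      ∷ (distinct 2F 3F (λ ()) ∷ distinct 2F 4F (λ ()) ∷ [])
      ∷ (distinct 3F 4F (λ ()) ∷ []) ∷ [] ∷ []
      , finish (census reps₅ (classified (along offsets₅) unit reps₅ (β - α ∷ []) z≈ (unit-nonzero t≉0) only₅))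
      where
      z = lookup (α ∷ β ∷ γ ∷ δ ∷ ε ∷ [])
      t≉0 : ¬ β - α ≈ 0#
      t≉0 = β≉α ∘ x-y≈0⇒x≈y
      z≈ : ∀ c → z c ≈ α + ⟦ along offsets₅ c ⟧ (β - α ∷ [])
      z≈ 0F = solve 2 (λ α β → α := α :+ (con 0ℤ :* (β :- α) :+ con 0ℤ)) ≈-refl α β
      z≈ 1F = solve 2 (λ α β → β := α :+ (con 1ℤ :* (β :- α) :+ con 0ℤ)) ≈-refl α β
      z≈ 2F = ≈-trans γ≈ (solve 2 (λ α β → 3 :· α :- 2 :· β := α :+ (con (ℤ.- + 2) :* (β :- α) :+ con 0ℤ)) ≈-refl α β)
      z≈ 3F = ≈-trans δ≈ (solve 2 (λ α β → 2 :· α :- β := α :+ (con -1ℤ :* (β :- α) :+ con 0ℤ)) ≈-refl α β)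
      z≈ 4F = ≈-trans ε≈ (solve 2 (λ α β → 2 :· β :- α := α :+ (con (+ 2) :* (β :- α) :+ con 0ℤ)) ≈-refl α β)
      distinct : ∀ a b → lookup offsets₅ a ℤ.- lookup offsets₅ b ≢ 0ℤ → ¬ z a ≈ z b
      distinct a b = offsets-distinct (lookup offsets₅ a) (lookup offsets₅ b) t≉0 (z≈ a) (z≈ b)
      open Coloured α 3α≈2π T z (0F ∷ 1F ∷ 2F ∷ 3F ∷ 4F ∷ []) pentagon
      finish : ∃ (Census reps₅) → _
      finish (n , combination , count) = by-cases
        (five-classes (n 0F) (n 1F) (n 2F) (n 3F) (n 4F)
          (count (within 0F 0F)) (count (within 1F 1F)) (count (within 2F 2F)) (count (within 4F 4F)))
        where
        with-multiplicities : ∀ {n₀ n₁ n₂ n₃ n₄} → n 0F ≡ n₀ → n 1F ≡ n₁ → n 2F ≡ n₂ → n 3F ≡ n₃ → n 4F ≡ n₄ →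
          VertexCombination
            ( (n₀ , α ∷ α ∷ α ∷ []) ∷ (n₁ , α ∷ β ∷ δ ∷ []) ∷ (n₂ , α ∷ γ ∷ ε ∷ [])
            ∷ (n₃ , β ∷ β ∷ γ ∷ []) ∷ (n₄ , δ ∷ δ ∷ ε ∷ []) ∷ [] )
        with-multiplicities ≡.refl ≡.refl ≡.refl ≡.refl ≡.refl = combination
        by-cases : _ → _
        -- An entry of multiplicity 0 contributes the empty list by computation, so α³ disappears
        -- from the first combination and αβδ from the third.
        by-cases (m , inj₁ ≡.refl , e₀ , e₁ , e₂ , e₃ , e₄)        = inj₁ (with-multiplicities e₀ e₁ e₂ e₃ e₄)
        by-cases (m , inj₂ (inj₁ ≡.refl) , e₀ , e₁ , e₂ , e₃ , e₄) = inj₂ (inj₁ (with-multiplicities e₀ e₁ e₂ e₃ e₄))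
        by-cases (m , inj₂ (inj₂ ≡.refl) , e₀ , e₁ , e₂ , e₃ , e₄) = inj₂ (inj₂ (with-multiplicities e₀ e₁ e₂ e₃ e₄))

-- Reduction to the five patterns

module Classification {c ℓ₁ ℓ₂} (K : OrderedField c ℓ₁ ℓ₂) where
  open Angles K renaming (refl to ≈-refl; sym to ≈-sym; trans to ≈-trans)
  open OrderedFieldProperties K
  open AngledTilingProperties K
  open Configurations K
  open Solver using (solve; _:+_; _:*_; _:-_; :-_; con; _:=_)
  open Setoid↭ setoid using (shifts)
  open SetoidPermutation setoid using (↭-refl; ↭-sym; ↭-prep)
  open Sort decTotalOrder using (SortingAlgorithm; sortingAlgorithm; sort; sort-↭; sort-↗)
  open SortingAlgorithm sortingAlgorithm using (sort-↭ₛ)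
  open import Relation.Binary.Reasoning.Setoid setoid

  module _ {π : Carrier} (α : Carrier) (3α≈2π : 3 · α ≈ 2 · π) (T : AngledTiling π 12) where
    open AngledTiling T using (PentagonAngles; VertexCombination; TilesAngleCongruent; tileAngles)

    Case₁ Case₂ Case₃ Case₄ Case₅ Cases : Set _
    Case₁ =
      ( PentagonAngles (α ∷ α ∷ α ∷ α ∷ α ∷ [])
      × VertexCombination ((20 , α ∷ α ∷ α ∷ []) ∷ []) )
    Case₂ =
      ( ∃[ β ] ∃[ γ ]
        ( Unique (α ∷ β ∷ γ ∷ [])
        × PentagonAngles (α ∷ α ∷ α ∷ β ∷ γ ∷ [])
        × β + γ ≈ 2 · α
        × VertexCombination ((8 , α ∷ α ∷ α ∷ []) ∷ (12 , α ∷ β ∷ γ ∷ []) ∷ []) ) )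
    Case₃ =
      ( ∃[ β ] ∃[ γ ]
        ( Unique (α ∷ β ∷ γ ∷ [])
        × PentagonAngles (α ∷ α ∷ β ∷ β ∷ γ ∷ [])
        × 2 · β + γ ≈ 3 · α
        × VertexCombination ((8 , α ∷ α ∷ α ∷ []) ∷ (12 , β ∷ β ∷ γ ∷ []) ∷ []) ) )
    Case₄ =
      ( ∃[ β ] ∃[ γ ] ∃[ δ ]
        ( Unique (α ∷ β ∷ γ ∷ δ ∷ [])
        × PentagonAngles (α ∷ α ∷ β ∷ γ ∷ δ ∷ [])
        × β + γ + δ ≈ 3 · α
        × VertexCombination ((8 , α ∷ α ∷ α ∷ []) ∷ (12 , β ∷ γ ∷ δ ∷ []) ∷ []) ) )
    Case₅ =
      ( ∃[ β ] ∃[ γ ] ∃[ δ ] ∃[ ε ]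
        ( Unique (α ∷ β ∷ γ ∷ δ ∷ ε ∷ [])
        × PentagonAngles (α ∷ β ∷ γ ∷ δ ∷ ε ∷ [])
        × γ ≈ 3 · α - 2 · β
        × δ ≈ 2 · α - β
        × ε ≈ 2 · β - α
        × ( VertexCombination
              ( (4 , α ∷ β ∷ δ ∷ []) ∷ (8 , α ∷ γ ∷ ε ∷ [])
              ∷ (4 , β ∷ β ∷ γ ∷ []) ∷ (4 , δ ∷ δ ∷ ε ∷ []) ∷ [] )
          ⊎ VertexCombination
              ( (1 , α ∷ α ∷ α ∷ []) ∷ (2 , α ∷ β ∷ δ ∷ []) ∷ (7 , α ∷ γ ∷ ε ∷ [])
              ∷ (5 , β ∷ β ∷ γ ∷ []) ∷ (5 , δ ∷ δ ∷ ε ∷ []) ∷ [] )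
          ⊎ VertexCombination
              ( (2 , α ∷ α ∷ α ∷ []) ∷ (6 , α ∷ γ ∷ ε ∷ [])
              ∷ (6 , β ∷ β ∷ γ ∷ []) ∷ (6 , δ ∷ δ ∷ ε ∷ []) ∷ [] ) ) ) )
    Cases = Case₁ ⊎ Case₂ ⊎ Case₃ ⊎ Case₄ ⊎ Case₅

    rearrange : ∀ {as bs} → as ↭ bs → PentagonAngles as → PentagonAngles bs
    rearrange as↭bs pentagon t = trans (pentagon t) as↭bs

    -- One test suffices, because the angle sum 5α turns β = α into γ = α.
    three-α : ∀ {β γ} → PentagonAngles (α ∷ α ∷ α ∷ β ∷ γ ∷ []) → Case₁ ⊎ Case₂
    three-α {β} {γ} pentagon with β ≈? α
    ... | no β≉α = inj₂ (β , γ , proj₁ result , pentagon , β+γ≈2α , proj₂ result)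
      where
      β+γ≈2α : β + γ ≈ 2 · α
      β+γ≈2α = begin
        β + γ
          ≈⟨ solve 3 (λ α β γ → β :+ γ := α :+ (α :+ (α :+ (β :+ (γ :+ con 0ℤ)))) :- 3 :· α) ≈-refl α β γ ⟩
        α + (α + (α + (β + (γ + 0#)))) - 3 · α         ≈⟨ +-congʳ (pentagon-sum α 3α≈2π T pentagon) ⟩
        5 · α - 3 · α                                  ≈⟨ solve 1 (λ α → 5 :· α :- 3 :· α := 2 :· α) ≈-refl α ⟩
        2 · α                                          ∎
      result = α³βγ α 3α≈2π T pentagon β≉α β+γ≈2α
    ... | yes β≈α = inj₁ (five-α , α⁵ α 3α≈2π T five-α)
      where
      γ≈α : γ ≈ α
      γ≈α = begin
        γ
          ≈⟨ solve 3 (λ α β γ → γ := α :+ (α :+ (α :+ (β :+ (γ :+ con 0ℤ)))) :- (3 :· α :+ β)) ≈-refl α β γ ⟩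
        α + (α + (α + (β + (γ + 0#)))) - (3 · α + β)   ≈⟨ +-cong (pentagon-sum α 3α≈2π T pentagon) (-‿cong (+-congˡ β≈α)) ⟩
        5 · α - (3 · α + α)                            ≈⟨ solve 1 (λ α → 5 :· α :- (3 :· α :+ α) := α) ≈-refl α ⟩
        α                                              ∎
      five-α : PentagonAngles (α ∷ α ∷ α ∷ α ∷ α ∷ [])
      five-α = rearrange (refl (≈-refl ∷ ≈-refl ∷ ≈-refl ∷ β≈α ∷ γ≈α ∷ [])) pentagon

    private
      widen₁₂ : Case₁ ⊎ Case₂ → Cases
      widen₁₂ (inj₁ case₁) = inj₁ case₁
      widen₁₂ (inj₂ case₂) = inj₂ (inj₁ case₂)

    two-β : ∀ {β γ} → PentagonAngles (α ∷ α ∷ β ∷ β ∷ γ ∷ []) → ¬ β ≈ α → Case₃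
    two-β {β} {γ} pentagon β≉α = β , γ , proj₁ result , pentagon , 2β+γ≈3α , proj₂ result
      where
      2β+γ≈3α : 2 · β + γ ≈ 3 · α
      2β+γ≈3α = begin
        2 · β + γ
          ≈⟨ solve 3 (λ α β γ → 2 :· β :+ γ := α :+ (α :+ (β :+ (β :+ (γ :+ con 0ℤ)))) :- 2 :· α) ≈-refl α β γ ⟩
        α + (α + (β + (β + (γ + 0#)))) - 2 · α         ≈⟨ +-congʳ (pentagon-sum α 3α≈2π T pentagon) ⟩
        5 · α - 2 · α                                  ≈⟨ solve 1 (λ α → 5 :· α :- 2 :· α := 3 :· α) ≈-refl α ⟩
        3 · α                                          ∎
      result = α²β²γ α 3α≈2π T pentagon β≉α 2β+γ≈3α

    -- A further angle α leads to `three-α`, and an equal pair different from α leads to `two-β`.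
    -- Otherwise all four values are distinct.
    two-α : ∀ {β γ δ} → PentagonAngles (α ∷ α ∷ β ∷ γ ∷ δ ∷ []) → Cases
    two-α {β} {γ} {δ} pentagon with β ≈? α | γ ≈? α | δ ≈? α | β ≈? γ | β ≈? δ | γ ≈? δ
    ... | yes β≈α | _ | _ | _ | _ | _ = widen₁₂ (three-α
      (rearrange (refl (≈-refl ∷ ≈-refl ∷ β≈α ∷ ≈-refl ∷ ≈-refl ∷ [])) pentagon))
    ... | _ | yes γ≈α | _ | _ | _ | _ = widen₁₂ (three-α
      (rearrange (prep ≈-refl (prep ≈-refl (swap ≈-refl γ≈α ↭-refl))) pentagon))
    ... | _ | _ | yes δ≈α | _ | _ | _ = widen₁₂ (three-α
      (rearrange (trans (↭-prep α (↭-prep α (shifts (β ∷ γ ∷ []) (δ ∷ []) {[]})))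
        (refl (≈-refl ∷ ≈-refl ∷ δ≈α ∷ ≈-refl ∷ ≈-refl ∷ []))) pentagon))
    ... | no β≉α | _ | _ | yes β≈γ | _ | _ = inj₂ (inj₂ (inj₁ (two-β
      (rearrange (refl (≈-refl ∷ ≈-refl ∷ ≈-refl ∷ ≈-sym β≈γ ∷ ≈-refl ∷ [])) pentagon) β≉α)))
    ... | no β≉α | _ | _ | _ | yes β≈δ | _ = inj₂ (inj₂ (inj₁ (two-β
      (rearrange (prep ≈-refl (prep ≈-refl (prep ≈-refl (swap ≈-refl (≈-sym β≈δ) ↭-refl)))) pentagon) β≉α)))
    ... | _ | no γ≉α | _ | _ | _ | yes γ≈δ = inj₂ (inj₂ (inj₁ (two-β
      (rearrange (trans (↭-prep α (↭-prep α (shifts (β ∷ []) (γ ∷ δ ∷ []) {[]})))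
        (refl (≈-refl ∷ ≈-refl ∷ ≈-refl ∷ ≈-sym γ≈δ ∷ ≈-refl ∷ []))) pentagon) γ≉α)))
    ... | no β≉α | no γ≉α | no δ≉α | no β≉γ | no β≉δ | no γ≉δ =
      inj₂ (inj₂ (inj₂ (inj₁ (β , γ , δ , distinct , pentagon , β+γ+δ≈3α , α²βγδ α 3α≈2π T pentagon distinct β+γ+δ≈3α))))
      where
      distinct : Unique (α ∷ β ∷ γ ∷ δ ∷ [])
      distinct = (β≉α ∘ ≈-sym ∷ γ≉α ∘ ≈-sym ∷ δ≉α ∘ ≈-sym ∷ []) ∷ (β≉γ ∷ β≉δ ∷ []) ∷ (γ≉δ ∷ []) ∷ [] ∷ []
      β+γ+δ≈3α : β + γ + δ ≈ 3 · α
      β+γ+δ≈3α = begin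
        β + γ + δ
          ≈⟨ solve 4 (λ α β γ δ → β :+ γ :+ δ := α :+ (α :+ (β :+ (γ :+ (δ :+ con 0ℤ)))) :- 2 :· α) ≈-refl α β γ δ ⟩
        α + (α + (β + (γ + (δ + 0#)))) - 2 · α         ≈⟨ +-congʳ (pentagon-sum α 3α≈2π T pentagon) ⟩
        5 · α - 2 · α                                  ≈⟨ solve 1 (λ α → 5 :· α :- 2 :· α := 3 :· α) ≈-refl α ⟩
        3 · α                                          ∎

    module _ {a b c d e : Carrier} (pentagon : PentagonAngles (a ∷ b ∷ c ∷ d ∷ e ∷ [])) where

      private
        y : Fin 5 → Carrier
        y = lookup (a ∷ b ∷ c ∷ d ∷ e ∷ [])

      consecutive : Consecutive α y → Cases
      consecutive (0F , a≈α , b≈α) = two-α (rearrange (refl (a≈α ∷ b≈α ∷ ≈-refl ∷ ≈-refl ∷ ≈-refl ∷ [])) pentagon)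
      consecutive (1F , b≈α , c≈α) = two-α (rearrange
        (trans (shifts (a ∷ []) (b ∷ c ∷ [])) (refl (b≈α ∷ c≈α ∷ ≈-refl ∷ ≈-refl ∷ ≈-refl ∷ []))) pentagon)
      consecutive (2F , c≈α , d≈α) = two-α (rearrange
        (trans (shifts (a ∷ b ∷ []) (c ∷ d ∷ [])) (refl (c≈α ∷ d≈α ∷ ≈-refl ∷ ≈-refl ∷ ≈-refl ∷ []))) pentagon)
      consecutive (3F , d≈α , e≈α) = two-α (rearrange
        (trans (shifts (a ∷ b ∷ c ∷ []) (d ∷ e ∷ []) {[]}) (refl (d≈α ∷ e≈α ∷ ≈-refl ∷ ≈-refl ∷ ≈-refl ∷ []))) pentagon)

      -- The common difference is t = d - α. If it is zero, `c` and `d` are two consecutive angles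
      -- α; otherwise the five angles are distinct.
      arithmetic : Arithmetic α y → Cases
      arithmetic (c≈α , b≈2α-d , a≈3α-2d , e≈2d-α) with d ≈? α
      ... | yes d≈α = consecutive (2F , c≈α , d≈α)
      ... | no d≉α  = inj₂ (inj₂ (inj₂ (inj₂
        -- The names in the statement are β = α + t, γ = α - 2t, δ = α - t and ε = α + 2t.
        (d , a , b , e , proj₁ result , reordered , a≈3α-2d , b≈2α-d , e≈2d-α , proj₂ result))))
        where
        reordered : PentagonAngles (α ∷ d ∷ a ∷ b ∷ e ∷ [])
        reordered = rearrange (trans (shifts (a ∷ b ∷ []) (c ∷ d ∷ [])) (prep c≈α ↭-refl)) pentagon
        result = αβγδε α 3α≈2π T reordered d≉α a≈3α-2d b≈2α-d e≈2d-α

      ascending : a ≤ b → b ≤ c → c ≤ d → d ≤ e → Cases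
      ascending a≤b b≤c c≤d d≤e = [ consecutive , arithmetic ]′
        (forced-sound pairs [] VecAll.[]
          ( two 0F 1F ≡.refl ∷ two 3F 4F ≡.refl ∷ two 0F 2F ≡.refl ∷ two 2F 4F ≡.refl
          ∷ two 0F 4F ≡.refl ∷ two 1F 2F ≡.refl ∷ two 2F 3F ≡.refl ∷ [])
          pairs-force)
        where
        steps : ∀ (i : Fin 4) → y (inject₁ i) ≤ y (suc i)
        steps = λ { 0F → a≤b ; 1F → b≤c ; 2F → c≤d ; 3F → d≤e }
        -- The colours are the five positions, so any two of them fill two corners of each tile even
        -- if the angles agree; `≡.refl` confirms this for each listed pair.
        open Coloured α 3α≈2π T y (allFin 5) pentagon renaming (full-with-two-of to two)
        open Ascending α y (pentagon-sum α 3α≈2π T pentagon) steps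

    -- The sorted angles of one tile serve as the common pattern of all tiles.
    classification : TilesAngleCongruent → Cases
    classification congruent = from-sorted _ (↭.↭-length (sort-↭ (tileAngles 0F))) (sort-↗ (tileAngles 0F))
      (λ t → trans (congruent⇒↭ α 3α≈2π T t 0F (congruent t 0F)) (↭-sym (sort-↭ₛ (tileAngles 0F))))
      where
      from-sorted : ∀ as → length as ≡ 5 → Linked _≤_ as → PentagonAngles as → Cases
      from-sorted (a ∷ b ∷ c ∷ d ∷ e ∷ []) _ (a≤b ∷ b≤c ∷ c≤d ∷ d≤e ∷ [-]) pentagon = ascending pentagon a≤b b≤c c≤d d≤e

proposition17 :
  ∀ {c ℓ₁ ℓ₂} (K : OrderedField c ℓ₁ ℓ₂) → let open Angles K in
  (π α : Carrier) → 0# < π → 3 · α ≈ 2 · π →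
  (T : AngledTiling π 12) → let open AngledTiling T in
  TilesAngleCongruent →
    -- α⁵
    ( PentagonAngles (α ∷ α ∷ α ∷ α ∷ α ∷ [])
    × VertexCombination ((20 , α ∷ α ∷ α ∷ []) ∷ []) )
  ⊎ -- α³βγ
    ( ∃[ β ] ∃[ γ ]
      ( Unique (α ∷ β ∷ γ ∷ [])
      × PentagonAngles (α ∷ α ∷ α ∷ β ∷ γ ∷ [])
      × β + γ ≈ 2 · α
      × VertexCombination ((8 , α ∷ α ∷ α ∷ []) ∷ (12 , α ∷ β ∷ γ ∷ []) ∷ []) ) )
  ⊎ -- α²β²γ
    ( ∃[ β ] ∃[ γ ]
      ( Unique (α ∷ β ∷ γ ∷ [])
      × PentagonAngles (α ∷ α ∷ β ∷ β ∷ γ ∷ [])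
      × 2 · β + γ ≈ 3 · α
      × VertexCombination ((8 , α ∷ α ∷ α ∷ []) ∷ (12 , β ∷ β ∷ γ ∷ []) ∷ []) ) )
  ⊎ -- α²βγδ
    ( ∃[ β ] ∃[ γ ] ∃[ δ ]
      ( Unique (α ∷ β ∷ γ ∷ δ ∷ [])
      × PentagonAngles (α ∷ α ∷ β ∷ γ ∷ δ ∷ [])
      × β + γ + δ ≈ 3 · α
      × VertexCombination ((8 , α ∷ α ∷ α ∷ []) ∷ (12 , β ∷ γ ∷ δ ∷ []) ∷ []) ) )
  ⊎ -- αβγδε
    ( ∃[ β ] ∃[ γ ] ∃[ δ ] ∃[ ε ]
      ( Unique (α ∷ β ∷ γ ∷ δ ∷ ε ∷ [])
      × PentagonAngles (α ∷ β ∷ γ ∷ δ ∷ ε ∷ [])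
      × γ ≈ 3 · α - 2 · β
      × δ ≈ 2 · α - β
      × ε ≈ 2 · β - α
      × ( VertexCombination
            ( (4 , α ∷ β ∷ δ ∷ []) ∷ (8 , α ∷ γ ∷ ε ∷ [])
            ∷ (4 , β ∷ β ∷ γ ∷ []) ∷ (4 , δ ∷ δ ∷ ε ∷ []) ∷ [] )
        ⊎ VertexCombination
            ( (1 , α ∷ α ∷ α ∷ []) ∷ (2 , α ∷ β ∷ δ ∷ []) ∷ (7 , α ∷ γ ∷ ε ∷ [])
            ∷ (5 , β ∷ β ∷ γ ∷ []) ∷ (5 , δ ∷ δ ∷ ε ∷ []) ∷ [] )
        ⊎ VertexCombination
            ( (2 , α ∷ α ∷ α ∷ []) ∷ (6 , α ∷ γ ∷ ε ∷ [])
            ∷ (6 , β ∷ β ∷ γ ∷ []) ∷ (6 , δ ∷ δ ∷ ε ∷ []) ∷ [] ) ) ) )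
proposition17 K π α _ 3α≈2π T = Classification.classification K α 3α≈2π T
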